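{- Let $(G,\chi)$ be a colored graph with vertex cover number $r$. Then $\mathrm{WLD}_1(G,\chi)\le \frac{2}{3}r+1$.
   Context: Graphs are finite, simple, undirected with non-empty vertex set; a colored graph $(G,\chi)$ has a vertex coloring $\chi\colon V(G)\to C$; $\mathrm{im}(\chi)$ is its set of colors. The vertex cover number is the minimum size of a set of vertices meeting every edge. For $k\ge1$, $\mathrm{WL}_k(G,\chi)$ denotes the stable coloring of $V(G)^k$ computed by the $k$-dimensional Weisfeiler--Leman algorithm (for $k=1$: color refinement, where a vertex's new color is its old color together with the multiset of its neighbors' old colors; for $k\ge2$: tuples initially colored by the isomorphism type of the induced ordered colored subgraph, and refined by the multiset over $w$ of the tuples of colors of $\bar v[w/1],\dots,\bar v[w/k]$). For a vertex $v$, $\mathrm{WL}_k(G,\chi)(v)$ means the color of $(v,\dots,v)$. For $u\in V(G)$, $\chi[u]$ is obtained from $\chi$ by giving $u$ a new unique color. A flip function for $(G,\chi)$ is a symmetric map $f\colon\mathrm{im}(\chi)^2\to\{0,1\}$; the $f$-flip $\mathrm{flip}_f(G,\chi)=(G',\chi)$ has $V(G')=V(G)$ and, for distinct $v,w$, $vw\in E(G')$ iff ($vw\in E(G)$ xor $f(\chi(v),\chi(w))=1$). A $k$-IRC tree of $(G,\chi)$ is a rooted tree $(T,r)$ with a map $\gamma$ assigning each node $t$ a colored graph $(G_t,\chi_t)$, with $\gamma(r)=(G,\chi)$, every leaf $t$ has $|V(G_t)|=1$, and each internal node $t$ satisfies at least one of: (D1) $t$ has one child $s$, $G_s=G_t$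 and $\chi_s(v)=\mathrm{WL}_k(G_t,\chi_t)(v)$ for all $v$; (D2) $t$ has one child $s$ with $(G_s,\chi_s)=\mathrm{flip}_f(G_t,\chi_t)$ for some flip function $f$; (D3) $G_t$ has connected components with vertex sets $A_1,\dots,A_\ell$ and $t$ has exactly $\ell$ children $s_i$ with $(G_{s_i},\chi_{s_i})=(G_t[A_i],\chi_t|_{A_i})$; (D4) $t$ has one child $s$ with $G_s=G_t$, $\chi_s=\chi_t[u]$ for some $u\in V(G_t)$. An individualization node is one satisfying (D4) but none of (D1)–(D3). The individualization depth of the tree is the maximum number of individualization nodes on a root-to-leaf path, and the $k$-WL depth $\mathrm{WLD}_k(G,\chi)$ is the minimum individualization depth over all $k$-IRC trees of $(G,\chi)$. -}

module Defs where

open import Data.Nat using (ℕ; zero; suc; _+_; _*_; _≤_; _≡ᵇ_)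
open import Data.Bool using (Bool; true; false; _∧_; _∨_; _xor_; if_then_else_; not)
open import Data.Fin using (Fin; zero; suc; _≟_)
open import Data.Fin.Subset using (Subset; _∈_; ∣_∣)
open import Data.Vec using (lookup; tabulate)
open import Data.Sum using (_⊎_)
open import Data.Product using (Σ; _×_)
open import Function using (_∘_)
open import Relation.Nullary using (¬_)
open import Relation.Nullary.Decidable using (⌊_⌋)
open import Relation.Binary.PropositionalEquality using (_≡_; _≢_)
open import Function.Bundles using (_⇔_)

countᵇ : ∀ {n} → (Fin n → Bool) → ℕ
countᵇ {zero}  p = 0
countᵇ {suc n} p = (if p zero then 1 else 0) + countᵇ (p ∘ suc)

allᵇ : ∀ {n} → (Fin n → Bool) → Bool
allᵇ {zero}  p = true
allᵇ {suc n} p = p zero ∧ allᵇ (p ∘ suc)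

anyᵇ : ∀ {n} → (Fin n → Bool) → Bool
anyᵇ {zero}  p = false
anyᵇ {suc n} p = p zero ∨ anyᵇ (p ∘ suc)

record Graph (N : ℕ) : Set where
  field
    adj    : Fin N → Fin N → Bool
    sym    : ∀ u v → adj u v ≡ adj v u
    irrefl : ∀ v → adj v v ≡ false

open Graph public

IsVertexCover : ∀ {N} → Graph N → Subset N → Set
IsVertexCover G C = ∀ u v → adj G u v ≡ true → (u ∈ C) ⊎ (v ∈ C)

IsVertexCoverNumber : ∀ {N} → Graph N → ℕ → Set
IsVertexCoverNumber G r =
  Σ (Subset _) (λ C → IsVertexCover G C × ∣ C ∣ ≡ r)
  × (∀ C → IsVertexCover G C → r ≤ ∣ C ∣)

-- Colored graphs occurring in IRC trees.  All of them have vertex set a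
-- subset VS of the vertex set Fin N of the root graph; only the values of
-- 'ad' and 'col' on VS are meaningful.  Colors are natural numbers.

record CGraph (N : ℕ) : Set where
  constructor cgraph
  field
    VS  : Subset N
    ad  : Fin N → Fin N → Bool
    col : Fin N → ℕ

open CGraph public

inV : ∀ {N} → CGraph N → Fin N → Bool
inV X v = lookup (VS X) v

root : ∀ {N} → Graph N → (Fin N → ℕ) → CGraph N
root G χ = cgraph (tabulate (λ _ → true)) (adj G) χ

-- Color refinement (1-WL).  wlEq X i v w = true iff v and w receive the
-- same color after i refinement rounds on (G_X, χ_X).  Round i+1 color of
-- v = (round i color, multiset of round-i colors of neighbours of v);
-- equality of the multisets is expressed by equality of, for each round-i
-- color class (represented by some vertex u), the number of neighbours in it.

wlEq : ∀ {N} → CGraph N → ℕ → Fin N → Fin N → Bool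
wlEq X zero    v w = col X v ≡ᵇ col X w
wlEq X (suc i) v w =
  wlEq X i v w ∧
  allᵇ (λ u → not (inV X u) ∨
    (countᵇ (λ x → inV X x ∧ ad X v x ∧ wlEq X i x u)
       ≡ᵇ countᵇ (λ x → inV X x ∧ ad X w x ∧ wlEq X i x u)))

-- the stable coloring: the partition after N rounds (|V(G_X)| ≤ N, so the
-- refinement has stabilised by then)
wlStableEq : ∀ {N} → CGraph N → Fin N → Fin N → Bool
wlStableEq {N} X = wlEq X N

IsWL1Coloring : ∀ {N} → CGraph N → (Fin N → ℕ) → Set
IsWL1Coloring X c =
  ∀ v w → v ∈ VS X → w ∈ VS X → (c v ≡ c w) ⇔ (wlStableEq X v w ≡ true)

IsFlipFunction : (ℕ → ℕ → Bool) → Set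
IsFlipFunction f = ∀ a b → f a b ≡ f b a

flip : ∀ {N} → (ℕ → ℕ → Bool) → CGraph N → CGraph N
flip f X = cgraph (VS X)
  (λ v w → if ⌊ v ≟ w ⌋ then false else (ad X v w xor f (col X v) (col X w)))
  (col X)

reach : ∀ {N} → CGraph N → ℕ → Fin N → Fin N → Bool
reach X zero    v w = inV X v ∧ ⌊ v ≟ w ⌋
reach X (suc k) v w =
  reach X k v w ∨ anyᵇ (λ x → reach X k v x ∧ ad X x w ∧ inV X w)

component : ∀ {N} → CGraph N → Fin N → Subset N
component {N} X v = tabulate (λ w → inV X w ∧ reach X N v w)

restrict : ∀ {N} → CGraph N → Subset N → CGraph N
restrict X A = cgraph A (ad X) (col X)

recolor : ∀ {N} → CGraph N → (Fin N → ℕ) → CGraph N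
recolor X c = cgraph (VS X) (ad X) c

-- HasIRCTree d X : there is a 1-IRC tree of X whose individualization
-- depth is at most d.  Each constructor is one kind of node; only
-- individualization nodes (D4) consume depth budget.  A node satisfying
-- D4 together with one of D1-D3 can be built with the D1-D3 constructor,
-- so it need not be counted, matching the paper's definition.

data HasIRCTree {N : ℕ} : ℕ → CGraph N → Set where
  leaf  : ∀ {d X} → ∣ VS X ∣ ≡ 1 → HasIRCTree d X
  d1    : ∀ {d X} (c : Fin N → ℕ) → IsWL1Coloring X c →
          HasIRCTree d (recolor X c) → HasIRCTree d X
  d2    : ∀ {d X} (f : ℕ → ℕ → Bool) → IsFlipFunction f →
          HasIRCTree d (flip f X) → HasIRCTree d X
  -- (D3) one child per connected component (indexed by any vertex of it)
  d3    : ∀ {d X} →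
          (∀ v → v ∈ VS X → HasIRCTree d (restrict X (component X v))) →
          HasIRCTree d X
  d4    : ∀ {d X} (u : Fin N) → u ∈ VS X → (c : Fin N → ℕ) →
          (∀ v → v ∈ VS X → v ≢ u → c v ≡ col X v) →
          (∀ v → v ∈ VS X → c u ≢ col X v) →
          HasIRCTree d (recolor X c) → HasIRCTree (suc d) X

{-# OPTIONS --safe #-}
module Submission where

-- Fix a vertex cover W.  Call a vertex covering if it lies in W; adjacency between
-- distinct uncovering vertices depends only on their colours, and this survives
-- refinement, flips and passing to components.  The potential of a colouring sums,
-- over the colour classes with a ≥ 1 covering vertices, 2a - 1 for mixed classes
-- (those with an uncovering vertex) and 2a - 2 for pure ones; it is at most 2r at
-- the root, and it suffices to pay 3 units of it per individualisation.
-- On a stable coloured graph with at least two vertices one of the following holds: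
-- individualising some vertex gains 3, individualising some two vertices gains 6,
-- or some flip disconnects the graph.  For suppose that nothing is gained.
--  * Individualising a covering vertex u whose class has another covering vertex
--    already gains 2, so it refines nothing else inside W and separates no mixed
--    class.  If the class of u is mixed, then u together with the uncovering
--    vertices on which u deviates from its behaviour on their covering classmates
--    is cut off by a flip.  So classes with two covering vertices are pure.
--  * The union of the classes with exactly one covering vertex is homogeneous to
--    the remaining classes; if it is the whole graph, a flip separates W from its
--    complement.
--  * If every class is pure, a counting of common neighbours shows that an
--    uncovering vertex is adjacent to at most one or to all but at most one vertex
--    of any class P inside W (two crossing neighbourhoods would cut P into four
--    pieces and gain 6), so u ∈ P with its pendant uncovering vertices is cut off
--    by a flip.

open import Algebra.Properties.CommutativeSemigroup using (interchange)
open import Data.Bool using (Bool; true; false; _∧_; _∨_; not; if_then_else_; _xor_)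
import Data.Bool as Bool
open import Data.Bool.Properties using (not-¬; ¬-not; xor-same; T-≡)
open import Data.Empty using (⊥; ⊥-elim)
open import Data.Fin using (Fin; zero; suc; _≟_)
import Data.Fin as Fin
open import Data.Fin.Properties using (any?; all?; <-cmp; _<?_)
open import Data.Fin.Subset using (Subset; _∈_; ∣_∣; ⁅_⁆)
open import Data.Fin.Subset.Properties using (anySubset?; ∣⁅x⁆∣≡1; ⊆-antisym; x∈⁅y⁆⇒x≡y; x∈⁅x⁆; p⊂q⇒∣p∣<∣q∣)
open import Data.Nat using (ℕ; zero; suc; _+_; _*_; _≤_; _<_; z≤n; s≤s; s≤s⁻¹; _≡ᵇ_)
import Data.Nat as ℕ
open import Data.Nat.DivMod using (_/_; _%_; m≡m%n+[m/n]*n; m%n<n)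
open import Data.Nat.Properties using (≤-refl; ≤-trans; ≤-antisym; ≤-reflexive; <-irrefl; n≮0; n<1+n; m≤n⇒m≤1+n; m<1+n⇒m<n∨m≡n; m≤m+n; m≤n+m; m+n≤o⇒n≤o; +-comm; +-suc; +-identityʳ; +-mono-≤; +-monoˡ-≤; +-mono-<-≤; +-mono-≤-<; +-cancelˡ-≡; +-cancelʳ-≤; +-commutativeSemigroup; suc-injective; ≡ᵇ⇒≡; ≡⇒≡ᵇ; *-comm)
open import Data.Product using (Σ; ∃; _×_; _,_; proj₁; proj₂)
open import Data.Product.Properties using (≡-dec)
open import Data.Sum using (_⊎_; inj₁; inj₂)
open import Data.Vec using (lookup; tabulate; []; _∷_)
open import Data.Vec.Properties using (lookup∘tabulate; []=⇒lookup; lookup⇒[]=)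
open import Defs renaming (sym to adj-sym; irrefl to adj-irrefl)
open import Function using (_∘_)
open import Function.Bundles using (mk⇔; Equivalence)
open import Relation.Binary.Definitions using (DecidableEquality; tri<; tri≈; tri>)
open import Relation.Binary.PropositionalEquality using (_≡_; _≢_; refl; sym; trans; cong; cong₂; subst; subst₂)
open import Relation.Nullary using (¬_; Dec; yes; no; does)
open import Relation.Nullary.Decidable using (⌊_⌋; map′; dec-true; dec-false; _×-dec_; _⊎-dec_; _→-dec_; ¬?; decidable-stable)

-- Counting in finite sets.

private variable
  n N : ℕ

true≢false : true ≢ false
true≢false ()

does⇒ : ∀ {P : Set} (P? : Dec P) → does P? ≡ true → P
does⇒ (yes p) _ = p

bit : Bool → ℕ
bit b = if b then 1 else 0

countᵇ-mono : {p q : Fin n → Bool} → (∀ x → p x ≡ true → q x ≡ true) → countᵇ p ≤ countᵇ q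
countᵇ-mono {zero} imp = z≤n
countᵇ-mono {suc n} {p} {q} imp with p zero in ep | q zero in eq
... | false | false = countᵇ-mono (λ x → imp (suc x))
... | false | true  = m≤n⇒m≤1+n (countᵇ-mono (λ x → imp (suc x)))
... | true  | true  = s≤s (countᵇ-mono (λ x → imp (suc x)))
... | true  | false with () ← trans (sym (imp zero ep)) eq

countᵇ-strict : {p q : Fin n → Bool} → (∀ x → p x ≡ true → q x ≡ true) →
  ∀ x → p x ≡ false → q x ≡ true → countᵇ p < countᵇ q
countᵇ-strict {suc n} {p} {q} imp zero px qx rewrite px | qx = s≤s (countᵇ-mono (λ x → imp (suc x)))
countᵇ-strict {suc n} {p} {q} imp (suc x) px qx with p zero in ep | q zero in eq
... | false | false = countᵇ-strict (λ x → imp (suc x)) x px qx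
... | false | true  = m≤n⇒m≤1+n (countᵇ-strict (λ x → imp (suc x)) x px qx)
... | true  | true  = s≤s (countᵇ-strict (λ x → imp (suc x)) x px qx)
... | true  | false with () ← trans (sym (imp zero ep)) eq

countᵇ-≤ : (p : Fin n → Bool) → countᵇ p ≤ n
countᵇ-≤ {zero} p = z≤n
countᵇ-≤ {suc n} p with p zero
... | true  = s≤s (countᵇ-≤ _)
... | false = m≤n⇒m≤1+n (countᵇ-≤ _)

countᵇ-none : {p : Fin n → Bool} → (∀ x → p x ≡ false) → countᵇ p ≡ 0
countᵇ-none {zero} h = refl
countᵇ-none {suc n} h rewrite h zero = countᵇ-none (λ x → h (suc x))

countᵇ-split : (p q : Fin n → Bool) →
  countᵇ p ≡ countᵇ (λ x → p x ∧ q x) + countᵇ (λ x → p x ∧ not (q x))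
countᵇ-split {zero} p q = refl
countᵇ-split {suc n} p q with p zero | q zero
... | false | _     = countᵇ-split (λ x → p (suc x)) (λ x → q (suc x))
... | true  | true  = cong suc (countᵇ-split (λ x → p (suc x)) (λ x → q (suc x)))
... | true  | false = trans (cong suc (countᵇ-split (λ x → p (suc x)) (λ x → q (suc x)))) (sym (+-suc _ _))

countᵇ-≟ : (x : Fin n) → countᵇ (λ z → does (z ≟ x)) ≡ 1
countᵇ-≟ {suc n} zero    = cong suc (countᵇ-none {n} {λ _ → false} (λ _ → refl))
countᵇ-≟ {suc n} (suc x) = countᵇ-≟ x

countᵇ-pair-mono : {p p′ q q′ : Fin n → Bool} →
  (∀ x → bit (p x) + bit (p′ x) ≤ bit (q x) + bit (q′ x)) →
  countᵇ p + countᵇ p′ ≤ countᵇ q + countᵇ q′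
countᵇ-pair-mono {zero} h = z≤n
countᵇ-pair-mono {suc n} {p} {p′} {q} {q′} h =
  subst₂ _≤_ (interchange +-commutativeSemigroup (bit (p zero)) _ _ _) (interchange +-commutativeSemigroup (bit (q zero)) _ _ _)
    (+-mono-≤ (h zero) (countᵇ-pair-mono (λ x → h (suc x))))

countᵇ-pair-strict : {p p′ q q′ : Fin n → Bool} →
  (∀ x → bit (p x) + bit (p′ x) ≤ bit (q x) + bit (q′ x)) →
  ∀ x → bit (p x) + bit (p′ x) < bit (q x) + bit (q′ x) →
  countᵇ p + countᵇ p′ < countᵇ q + countᵇ q′
countᵇ-pair-strict {suc n} {p} {p′} {q} {q′} h x lt =
  subst₂ _<_ (interchange +-commutativeSemigroup (bit (p zero)) _ _ _) (interchange +-commutativeSemigroup (bit (q zero)) _ _ _) (go x lt)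
  where
  go : ∀ x → bit (p x) + bit (p′ x) < bit (q x) + bit (q′ x) →
    (bit (p zero) + bit (p′ zero)) + (countᵇ (λ x → p (suc x)) + countᵇ (λ x → p′ (suc x)))
    < (bit (q zero) + bit (q′ zero)) + (countᵇ (λ x → q (suc x)) + countᵇ (λ x → q′ (suc x)))
  go zero lt    = +-mono-<-≤ lt (countᵇ-pair-mono (λ x → h (suc x)))
  go (suc x) lt = +-mono-≤-< (h zero) (countᵇ-pair-strict (λ x → h (suc x)) x lt)

count : {P : Fin n → Set} → (∀ x → Dec (P x)) → ℕ
count P? = countᵇ (λ x → does (P? x))

module _ {P Q : Fin n → Set} (P? : ∀ x → Dec (P x)) (Q? : ∀ x → Dec (Q x)) where

  private
    imp : (∀ x → P x → Q x) → ∀ x → does (P? x) ≡ true → does (Q? x) ≡ true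
    imp f x e = dec-true (Q? x) (f x (does⇒ (P? x) e))

  count-mono : (∀ x → P x → Q x) → count P? ≤ count Q?
  count-mono f = countᵇ-mono (imp f)

  count-strict : (∀ x → P x → Q x) → ∀ x → ¬ P x → Q x → count P? < count Q?
  count-strict f x ¬p q = countᵇ-strict (imp f) x (dec-false (P? x) ¬p) (dec-true (Q? x) q)

  count-split : count P? ≡ count (λ x → P? x ×-dec Q? x) + count (λ x → P? x ×-dec ¬? (Q? x))
  count-split = countᵇ-split (λ x → does (P? x)) (λ x → does (Q? x))

module _ {P Q : Fin n → Set} (P? : ∀ x → Dec (P x)) (Q? : ∀ x → Dec (Q x)) where

  count-cong : (∀ x → P x → Q x) → (∀ x → Q x → P x) → count P? ≡ count Q?
  count-cong f g = ≤-antisym (count-mono P? Q? f) (count-mono Q? P? g)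

  count-∃ : count P? ≡ count Q? → ∃ P → ∃ Q
  count-∃ e (x , px) with any? Q?
  ... | yes q = q
  ... | no ¬q = ⊥-elim (<-irrefl (sym e) (count-strict Q? P? (λ y qy → ⊥-elim (¬q (y , qy))) x (λ qx → ¬q (x , qx)) px))

_∖_ : {P : Fin n → Set} → (∀ x → Dec (P x)) → (v : Fin n) → ∀ x → Dec (P x × x ≢ v)
(P? ∖ v) x = P? x ×-dec ¬? (x ≟ v)

count-remove : {P : Fin n → Set} (P? : ∀ x → Dec (P x)) → ∀ v → P v → count P? ≡ suc (count (P? ∖ v))
count-remove P? v pv = trans (count-split P? (_≟ v)) (cong (_+ count (P? ∖ v)) one)
  where
  one : count (λ x → P? x ×-dec (x ≟ v)) ≡ 1
  one = trans (count-cong (λ x → P? x ×-dec (x ≟ v)) (_≟ v) (λ _ → proj₂) (λ { .v refl → pv , refl })) (countᵇ-≟ v)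

count-∃₂ : {P Q : Fin n → Set} (P? : ∀ x → Dec (P x)) (Q? : ∀ x → Dec (Q x)) → count P? ≡ count Q? →
  ∀ {x x′} → x ≢ x′ → P x → P x′ → ∃ λ y → ∃ λ y′ → y ≢ y′ × Q y × Q y′
count-∃₂ P? Q? e {x} {x′} x≢x′ px px′ with count-∃ P? Q? e (x , px)
... | y , qy with count-∃ (P? ∖ x) (Q? ∖ y)
      (suc-injective (trans (sym (count-remove P? x px)) (trans e (count-remove Q? y qy))))
      (x′ , px′ , λ x′≡x → x≢x′ (sym x′≡x))
...   | y′ , qy′ , y′≢y = y , y′ , (λ y≡y′ → y′≢y (sym y≡y′)) , qy , qy′

least : {P : Fin n → Set} → (∀ x → Dec (P x)) → ∃ P → ∃ λ x → P x × (∀ y → y Fin.< x → ¬ P y)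
least {suc n} P? (x , px) with P? zero
... | yes p0 = zero , p0 , λ _ ()
least {suc n} P? (zero , px)  | no ¬p0 = ⊥-elim (¬p0 px)
least {suc n} P? (suc x , px) | no ¬p0 with least (λ y → P? (suc y)) (x , px)
... | z , pz , min = suc z , pz , λ { zero _ → ¬p0 ; (suc y) (s≤s y<z) → min y y<z }

-- Used as an upper bound for all values of `f`: it limits the range of colours and, increased by
-- one, gives a fresh colour.
total : (Fin n → ℕ) → ℕ
total {zero}  f = 0
total {suc n} f = f zero + total (λ x → f (suc x))

≤-total-sum : (f : Fin n → ℕ) → ∀ x → f x ≤ total f
≤-total-sum {suc n} f zero    = m≤m+n (f zero) _
≤-total-sum {suc n} f (suc x) = ≤-trans (≤-total-sum (λ y → f (suc y)) x) (m≤n+m _ (f zero))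

-- Redundant covering vertices and the potential.

Finer : {K K′ : Set} → (Fin n → Bool) → (Fin n → K′) → (Fin n → K) → Set
Finer V k′ k = ∀ x y → V x ≡ true → V y ≡ true → k′ x ≡ k′ y → k x ≡ k y

module Potential {N : ℕ} (V W : Fin N → Bool) where

  Covering : Fin N → Set
  Covering x = V x ≡ true × W x ≡ true

  module _ (Z : Fin N → Set) (Z? : ∀ x → Dec (Z x)) {K : Set} (_≟K_ : DecidableEquality K) (k : Fin N → K) where

    -- Vertices of `Z` count as preceding every covering vertex. Hence a class with a ≥ 1 covering
    -- vertices has a redundant ones if it meets `Z`, and a - 1 otherwise. The colour type stays
    -- open so that partitions between two colourings, such as pairs of a colour and a bit, can be
    -- measured too.
    Earlier : Fin N → Fin N → Set
    Earlier w x = V x ≡ true × (Z x ⊎ (W x ≡ true × x Fin.< w)) × k x ≡ k w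

    Redundant : Fin N → Set
    Redundant w = Covering w × ∃ (Earlier w)

    redundant? : ∀ w → Dec (Redundant w)
    redundant? w = ((V w Bool.≟ true) ×-dec (W w Bool.≟ true)) ×-dec any? (λ x →
      (V x Bool.≟ true) ×-dec (Z? x ⊎-dec ((W x Bool.≟ true) ×-dec (x <? w))) ×-dec (k x ≟K k w))

    redundancy : ℕ
    redundancy = count redundant?

  module _ (Z : Fin N → Set) (Z? : ∀ x → Dec (Z x)) {K K′ : Set} (_≟K_ : DecidableEquality K) (_≟K′_ : DecidableEquality K′)
           (k : Fin N → K) (k′ : Fin N → K′) (finer : Finer V k′ k) where

    private
      imp : ∀ w → Redundant Z Z? _≟K′_ k′ w → Redundant Z Z? _≟K_ k w
      imp w (cw@(vw , _) , x , vx , h , e) = cw , x , vx , h , finer x w vx vw e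

    redundancy-mono : redundancy Z Z? _≟K′_ k′ ≤ redundancy Z Z? _≟K_ k
    redundancy-mono = count-mono (redundant? Z Z? _≟K′_ k′) (redundant? Z Z? _≟K_ k) imp

    -- Let `a₀` be the first covering vertex of the new class of `a`; as that class is free of `Z`,
    -- `a₀` is no longer redundant. If the old class meets `Z`, then `a₀` was redundant before.
    -- Otherwise `b` is covering, and with `b₀` first in its new class, the later of `a₀` and `b₀`
    -- loses its redundancy.
    redundancy-strict : ∀ a b → Covering a → V b ≡ true → W b ≡ true ⊎ Z b →
      k a ≡ k b → k′ a ≢ k′ b → (∀ x → V x ≡ true → k′ x ≡ k′ a → ¬ Z x) →
      redundancy Z Z? _≟K′_ k′ < redundancy Z Z? _≟K_ k
    redundancy-strict a b ca@(va , _) vb wzb kab k′ab freeA = result wzb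
      where
      first : ∀ y → Covering y → ∃ λ x → (Covering x × k′ x ≡ k′ y) × (∀ z → z Fin.< x → ¬ (Covering z × k′ z ≡ k′ y))
      first y cy = least (λ x → ((V x Bool.≟ true) ×-dec (W x Bool.≟ true)) ×-dec (k′ x ≟K′ k′ y)) (y , cy , refl)

      fresh : ∀ x y → k′ x ≡ k′ y → (∀ z → z Fin.< x → ¬ (Covering z × k′ z ≡ k′ y)) →
        (∀ z → V z ≡ true → k′ z ≡ k′ y → ¬ Z z) → ¬ Redundant Z Z? _≟K′_ k′ x
      fresh x y e min free (_ , z , vz , inj₁ zz , e′) = free z vz (trans e′ e) zz
      fresh x y e min free (_ , z , vz , inj₂ (wz , z<x) , e′) = min z z<x ((vz , wz) , trans e′ e)

      conclude : ∀ x → ¬ Redundant Z Z? _≟K′_ k′ x → Redundant Z Z? _≟K_ k x →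
        redundancy Z Z? _≟K′_ k′ < redundancy Z Z? _≟K_ k
      conclude = count-strict (redundant? Z Z? _≟K′_ k′) (redundant? Z Z? _≟K_ k) imp

      result : W b ≡ true ⊎ Z b → redundancy Z Z? _≟K′_ k′ < redundancy Z Z? _≟K_ k
      result wzb with first a ca
      ... | a₀ , (ca₀@(va₀ , wa₀) , ea₀) , mina with any? (λ z → (V z Bool.≟ true) ×-dec Z? z ×-dec (k z ≟K k a))
      ...   | yes (z , vz , zz , ez) = conclude a₀ (fresh a₀ a ea₀ mina freeA)
                (ca₀ , z , vz , inj₁ zz , trans ez (sym (finer a₀ a va₀ va ea₀)))
      ...   | no noZ with wzb
      ...     | inj₂ zb = ⊥-elim (noZ (b , vb , zb , sym kab))
      ...     | inj₁ wb with first b (vb , wb)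
      ...       | b₀ , (cb₀@(vb₀ , wb₀) , eb₀) , minb = compare
        where
        ka₀b₀ : k a₀ ≡ k b₀
        ka₀b₀ = trans (finer a₀ a va₀ va ea₀) (trans kab (sym (finer b₀ b vb₀ vb eb₀)))
        freeB : ∀ z → V z ≡ true → k′ z ≡ k′ b → ¬ Z z
        freeB z vz e zz = noZ (z , vz , zz , trans (finer z b vz vb e) (sym kab))
        compare : redundancy Z Z? _≟K′_ k′ < redundancy Z Z? _≟K_ k
        compare with <-cmp a₀ b₀
        ... | tri< a<b _ _ = conclude b₀ (fresh b₀ b eb₀ minb freeB) (cb₀ , a₀ , va₀ , inj₂ (wa₀ , a<b) , ka₀b₀)
        ... | tri≈ _ refl _ = ⊥-elim (k′ab (trans (sym ea₀) eb₀))
        ... | tri> _ _ b<a = conclude a₀ (fresh a₀ a ea₀ mina freeA) (ca₀ , b₀ , vb₀ , inj₂ (wb₀ , b<a) , sym ka₀b₀)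

  Uncovering : Fin N → Set
  Uncovering x = V x ≡ true × W x ≡ false

  uncovering? : ∀ x → Dec (Uncovering x)
  uncovering? x = (V x Bool.≟ true) ×-dec (W x Bool.≟ false)

  covering? : ∀ x → Dec (Covering x)
  covering? x = (V x Bool.≟ true) ×-dec (W x Bool.≟ true)

  None : Fin N → Set
  None _ = ⊥

  none? : ∀ x → Dec (None x)
  none? _ = no (λ ())

  -- A colour class with a ≥ 1 covering vertices contributes 2a - 1 if it contains
  -- an uncovering vertex and 2a - 2 otherwise.
  potential : (Fin N → ℕ) → ℕ
  potential k = redundancy None none? ℕ._≟_ k + redundancy Uncovering uncovering? ℕ._≟_ k

  potential-mono : ∀ {k k′} → Finer V k′ k → potential k′ ≤ potential k
  potential-mono {k} {k′} f = +-mono-≤ (redundancy-mono None none? ℕ._≟_ ℕ._≟_ k k′ f)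
    (redundancy-mono Uncovering uncovering? ℕ._≟_ ℕ._≟_ k k′ f)

-- Equitable colourings and transfer of links between classmates.

module Equitability {N : ℕ} (V : Fin N → Bool) (A : Fin N → Fin N → Bool) where

  nbr? : {T : Fin N → Set} → (∀ x → Dec (T x)) → ∀ v x → Dec (V x ≡ true × T x × A v x ≡ true)
  nbr? T? v x = (V x Bool.≟ true) ×-dec T? x ×-dec (A v x Bool.≟ true)

  Equitable : (Fin N → ℕ) → Set
  Equitable k = ∀ v w u → V v ≡ true → V w ≡ true → V u ≡ true → k v ≡ k w →
    count (nbr? (λ x → k x ℕ.≟ k u) v) ≡ count (nbr? (λ x → k x ℕ.≟ k u) w)

  Invariant : (Fin N → ℕ) → (Fin N → Set) → Set
  Invariant k T = ∀ x y → V x ≡ true → V y ≡ true → k x ≡ k y → T x → T y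

  module _ {k : Fin N → ℕ} (eq : Equitable k) {T : Fin N → Set} (T? : ∀ x → Dec (T x)) (inv : Invariant k T)
           {v w : Fin N} (vv : V v ≡ true) (vw : V w ≡ true) (kvw : k v ≡ k w) where

    private
      below? : ∀ m x → Dec (T x × k x < m)
      below? m x = T? x ×-dec (k x ℕ.<? m)

      at? : ∀ m x → Dec (T x × k x ≡ m)
      at? m x = T? x ×-dec (k x ℕ.≟ m)

      at-eq : ∀ m → count (nbr? (at? m) v) ≡ count (nbr? (at? m) w)
      at-eq m with any? (λ x → (V x Bool.≟ true) ×-dec at? m x)
      ... | yes (u , vu , tu , ku) = trans (lem v) (trans (eq v w u vv vw vu kvw) (sym (lem w)))
        where
        lem : ∀ z → count (nbr? (at? m) z) ≡ count (nbr? (λ x → k x ℕ.≟ k u) z)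
        lem z = count-cong (nbr? (at? m) z) (nbr? (λ x → k x ℕ.≟ k u) z)
          (λ { x (vx , (tx , kx) , ax) → vx , trans kx (sym ku) , ax })
          (λ { x (vx , kx , ax) → vx , (inv u x vu vx (sym kx) tu , trans kx ku) , ax })
      ... | no none = count-cong (nbr? (at? m) v) (nbr? (at? m) w)
          (λ { x (vx , t , _) → ⊥-elim (none (x , vx , t)) })
          (λ { x (vx , t , _) → ⊥-elim (none (x , vx , t)) })

      step : ∀ m z → count (nbr? (below? (suc m)) z) ≡ count (nbr? (at? m) z) + count (nbr? (below? m) z)
      step m z = trans (count-split (nbr? (below? (suc m)) z) (λ x → k x ℕ.≟ m)) (cong₂ _+_
        (count-cong (λ x → nbr? (below? (suc m)) z x ×-dec (k x ℕ.≟ m)) (nbr? (at? m) z)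
          (λ { x ((vx , (tx , _) , ax) , e) → vx , (tx , e) , ax })
          (λ { x (vx , (tx , refl) , ax) → (vx , (tx , n<1+n _) , ax) , refl }))
        (count-cong (λ x → nbr? (below? (suc m)) z x ×-dec ¬? (k x ℕ.≟ m)) (nbr? (below? m) z) forth
          (λ { x (vx , (tx , l) , ax) → (vx , (tx , m≤n⇒m≤1+n l) , ax) , λ e → <-irrefl e l })))
        where
        forth : ∀ x → (V x ≡ true × (T x × k x < suc m) × A z x ≡ true) × k x ≢ m → V x ≡ true × (T x × k x < m) × A z x ≡ true
        forth x ((vx , (tx , l) , ax) , ne) with m<1+n⇒m<n∨m≡n l
        ... | inj₁ l′ = vx , (tx , l′) , ax
        ... | inj₂ e = ⊥-elim (ne e)

      below-eq : ∀ m → count (nbr? (below? m) v) ≡ count (nbr? (below? m) w)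
      below-eq zero = count-cong (nbr? (below? 0) v) (nbr? (below? 0) w)
        (λ { x (_ , (_ , ()) , _) }) (λ { x (_ , (_ , ()) , _) })
      below-eq (suc m) = trans (step m v) (trans (cong₂ _+_ (at-eq m) (below-eq m)) (sym (step m w)))

    -- `T` is a union of classes, so the count is accumulated colour by colour. A colour occurring
    -- in `T` contributes equally by equitability at a representative; any other contributes
    -- nothing.
    nbr-count : count (nbr? T? v) ≡ count (nbr? T? w)
    nbr-count = trans (lem v) (trans (below-eq M) (sym (lem w)))
      where
      M = suc (total k)
      lem : ∀ z → count (nbr? T? z) ≡ count (nbr? (below? M) z)
      lem z = count-cong (nbr? T? z) (nbr? (below? M) z)
        (λ { x (vx , tx , ax) → vx , (tx , s≤s (≤-total-sum k x)) , ax })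
        (λ { x (vx , (tx , _) , ax) → vx , tx , ax })

  -- Pairs are compared with a prescribed value γ of the adjacency matrix, so that
  -- every statement below is insensitive to complementing between colour classes.
  link? : {T : Fin N → Set} → (∀ x → Dec (T x)) → ∀ γ v x → Dec (V x ≡ true × T x × x ≢ v × A v x ≡ γ)
  link? T? γ v x = (V x Bool.≟ true) ×-dec T? x ×-dec ¬? (x ≟ v) ×-dec (A v x Bool.≟ γ)

  module Links (irr : ∀ x → V x ≡ true → A x x ≡ false) {k : Fin N → ℕ} (eq : Equitable k) where

    -- For `true`, irreflexivity already excludes `v` itself. For `false`, neighbours are subtracted
    -- from all of `T`; a vertex of `T` is among its own non-neighbours, which shifts the count by
    -- one, and invariance makes this happen for `v` and `w` alike.
    link-count : {T : Fin N → Set} (T? : ∀ x → Dec (T x)) → Invariant k T → ∀ γ {v w} →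
      V v ≡ true → V w ≡ true → k v ≡ k w → count (link? T? γ v) ≡ count (link? T? γ w)
    link-count T? inv true {v} {w} vv vw kvw = trans (lem v vv) (trans (nbr-count eq T? inv vv vw kvw) (sym (lem w vw)))
      where
      lem : ∀ z → V z ≡ true → count (link? T? true z) ≡ count (nbr? T? z)
      lem z vz = count-cong (link? T? true z) (nbr? T? z) (λ { x (vx , tx , _ , ax) → vx , tx , ax })
        (λ { x (vx , tx , ax) → vx , tx , (λ { refl → true≢false (trans (sym ax) (irr z vz)) }) , ax })
    link-count {T} T? inv false {v} {w} vv vw kvw = by (T? v) (T? w)
      where
      VT? : ∀ x → Dec (V x ≡ true × T x)
      VT? x = (V x Bool.≟ true) ×-dec T? x

      far? : ∀ z x → Dec (V x ≡ true × T x × A z x ≢ true)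
      far? z x = (V x Bool.≟ true) ×-dec T? x ×-dec ¬? (A z x Bool.≟ true)

      split : ∀ z → count VT? ≡ count (nbr? T? z) + count (far? z)
      split z = trans (count-split VT? (λ x → A z x Bool.≟ true)) (cong₂ _+_
        (count-cong (λ x → VT? x ×-dec (A z x Bool.≟ true)) (nbr? T? z) (λ { x ((a , b) , c) → a , b , c }) (λ { x (a , b , c) → (a , b) , c }))
        (count-cong (λ x → VT? x ×-dec ¬? (A z x Bool.≟ true)) (far? z) (λ { x ((a , b) , c) → a , b , c }) (λ { x (a , b , c) → (a , b) , c })))

      far-eq : count (far? v) ≡ count (far? w)
      far-eq = +-cancelˡ-≡ (count (nbr? T? v)) _ _
        (trans (sym (split v)) (trans (split w) (cong (_+ count (far? w)) (sym (nbr-count eq T? inv vv vw kvw)))))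

      forth : ∀ z x → V x ≡ true × T x × x ≢ z × A z x ≡ false → (V x ≡ true × T x × A z x ≢ true)
      forth z x (vx , tx , _ , ax) = vx , tx , λ e → true≢false (trans (sym e) ax)

      inside : ∀ z → V z ≡ true → T z → suc (count (link? T? false z)) ≡ count (far? z)
      inside z vz tz = sym (trans (count-remove (far? z) z (vz , tz , λ e → true≢false (trans (sym e) (irr z vz))))
        (cong suc (count-cong (far? z ∖ z) (link? T? false z)
          (λ { x ((vx , tx , ax) , ne) → vx , tx , ne , ¬-not ax })
          (λ x l → forth z x l , proj₁ (proj₂ (proj₂ l))))))

      outside : ∀ z → ¬ T z → count (link? T? false z) ≡ count (far? z)
      outside z ¬tz = count-cong (link? T? false z) (far? z) (forth z)
        (λ { x (vx , tx , ax) → vx , tx , (λ { refl → ¬tz tx }) , ¬-not ax })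

      by : Dec (T v) → Dec (T w) → count (link? T? false v) ≡ count (link? T? false w)
      by (yes tv) (yes tw) = suc-injective (trans (inside v vv tv) (trans far-eq (sym (inside w vw tw))))
      by (no ¬tv) (no ¬tw) = trans (outside v ¬tv) (trans far-eq (sym (outside w ¬tw)))
      by (yes tv) (no ¬tw) = ⊥-elim (¬tw (inv v w vv vw kvw tv))
      by (no ¬tv) (yes tw) = ⊥-elim (¬tv (inv w v vw vv (sym kvw) tw))

    class? : ∀ q x → Dec (k x ≡ k q)
    class? q x = k x ℕ.≟ k q

    class-inv : ∀ q → Invariant k (λ x → k x ≡ k q)
    class-inv q x y _ _ e e′ = trans (sym e) e′

    link-transfer : ∀ {v w q} γ → V v ≡ true → V w ≡ true → k v ≡ k w →
      V q ≡ true → q ≢ v → A v q ≡ γ → ∃ λ r → V r ≡ true × k r ≡ k q × r ≢ w × A w r ≡ γ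
    link-transfer {v} {w} {q} γ vv vw kvw vq ne aq =
      count-∃ (link? (class? q) γ v) (link? (class? q) γ w) (link-count (class? q) (class-inv q) γ vv vw kvw) (q , vq , refl , ne , aq)

    link-transfer₂ : ∀ {v w q q′} γ → V v ≡ true → V w ≡ true → k v ≡ k w →
      V q ≡ true → q ≢ v → A v q ≡ γ → V q′ ≡ true → q′ ≢ v → A v q′ ≡ γ → k q′ ≡ k q → q ≢ q′ →
      ∃ λ r → ∃ λ r′ → r ≢ r′ × (V r ≡ true × k r ≡ k q × r ≢ w × A w r ≡ γ) × (V r′ ≡ true × k r′ ≡ k q × r′ ≢ w × A w r′ ≡ γ)
    link-transfer₂ {v} {w} {q} γ vv vw kvw vq ne aq vq′ ne′ aq′ e q≢q′ =
      count-∃₂ (link? (class? q) γ v) (link? (class? q) γ w) (link-count (class? q) (class-inv q) γ vv vw kvw)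
        q≢q′ (vq , refl , ne , aq) (vq′ , e , ne′ , aq′)

    -- A link of the negated value at `w` would transfer back to one at `v`.
    homogeneous-transfer : ∀ {v w q} γ → V v ≡ true → V w ≡ true → k v ≡ k w → 
      (∀ r → V r ≡ true → k r ≡ k q → r ≢ v → A v r ≡ γ) →
      (∀ r → V r ≡ true → k r ≡ k q → r ≢ w → A w r ≡ γ)
    homogeneous-transfer {v} {w} {q} γ vv vw kvw h r vr kr r≢w with A w r Bool.≟ γ
    ... | yes e = e
    ... | no ne with link-transfer {w} {v} {r} (not γ) vw vv (sym kvw) vr r≢w (¬-not ne)
    ...   | s , vs , ks , s≢v , as = ⊥-elim (not-¬ (h s vs (trans ks kr) s≢v) as)

    singleton-adjacency : ∀ {s x y} → V s ≡ true → (∀ z → V z ≡ true → k z ≡ k s → z ≡ s) →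
      V x ≡ true → V y ≡ true → k x ≡ k y → A x s ≡ A y s
    singleton-adjacency {s} {x} {y} vs single vx vy kxy with s ≟ x
    ... | yes refl with single y vy (sym kxy)
    ...   | refl = refl
    singleton-adjacency {s} {x} {y} vs single vx vy kxy | no s≢x
      with link-transfer {x} {y} {s} (A x s) vx vy kxy vs s≢x refl
    ... | r , vr , kr , _ , ar with single r vr kr
    ...   | refl = sym ar

-- Colour refinement is stable after N rounds.

∧-true : ∀ {a b} → a ∧ b ≡ true → a ≡ true × b ≡ true
∧-true {true} {true} _ = refl , refl

≡ᵇ-true⇒≡ : ∀ m n → (m ≡ᵇ n) ≡ true → m ≡ n
≡ᵇ-true⇒≡ m n e = ≡ᵇ⇒≡ m n (Equivalence.from T-≡ e)

≡⇒≡ᵇ-true : ∀ m n → m ≡ n → (m ≡ᵇ n) ≡ true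
≡⇒≡ᵇ-true m n e = Equivalence.to T-≡ (≡⇒≡ᵇ m n e)

allᵇ-elim : {p : Fin n → Bool} → allᵇ p ≡ true → ∀ x → p x ≡ true
allᵇ-elim e zero    = proj₁ (∧-true e)
allᵇ-elim {p = p} e (suc x) = allᵇ-elim (proj₂ (∧-true {p zero} e)) x

allᵇ-intro : {p : Fin n → Bool} → (∀ x → p x ≡ true) → allᵇ p ≡ true
allᵇ-intro {zero}  h = refl
allᵇ-intro {suc n} h = cong₂ _∧_ (h zero) (allᵇ-intro (h ∘ suc))

-- Applied to an equivalence class, this is its least member, a canonical colour for the class.
index : (Fin n → Bool) → ℕ
index {zero}  p = 0
index {suc n} p with p zero
... | true  = 0
... | false = suc (index (p ∘ suc))

index-cong : {p q : Fin n → Bool} → (∀ x → p x ≡ q x) → index p ≡ index q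
index-cong {zero} h = refl
index-cong {suc n} {p} {q} h with p zero | q zero | h zero
... | true  | _ | refl = refl
... | false | _ | refl = cong suc (index-cong (h ∘ suc))

index-common : {p q : Fin n → Bool} → index p ≡ index q → ∃ (λ x → p x ≡ true) → ∃ (λ x → q x ≡ true) →
  ∃ λ x → p x ≡ true × q x ≡ true
index-common {suc n} {p} {q} e px qx with p zero in ep | q zero in eq
... | true  | true  = zero , ep , eq
index-common {suc n} {p} {q} e (zero , px) qx | false | _ = ⊥-elim (true≢false (trans (sym px) ep))
index-common {suc n} {p} {q} e px (zero , qx) | _ | false = ⊥-elim (true≢false (trans (sym qx) eq))
index-common {suc n} {p} {q} e (suc x , px) (suc y , qx) | false | false with index-common (cong ℕ.pred e) (x , px) (y , qx)
... | z , pz , qz = suc z , pz , qz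

bool-ext : ∀ {a b} → (a ≡ true → b ≡ true) → (b ≡ true → a ≡ true) → a ≡ b
bool-ext {true}  {true}  _ _ = refl
bool-ext {false} {false} _ _ = refl
bool-ext {true}  {false} f _ = sym (f refl)
bool-ext {false} {true}  _ g = g refl

countᵇ-cong : {p q : Fin n → Bool} → (∀ x → p x ≡ q x) → countᵇ p ≡ countᵇ q
countᵇ-cong {zero}  h = refl
countᵇ-cong {suc n} h rewrite h zero = cong (_ +_) (countᵇ-cong (h ∘ suc))

module Refinement (X : CGraph N) where

  private
    V = inV X
    A = ad X
  open Equitability V A

  classCount : ℕ → Fin N → Fin N → ℕ
  classCount i v u = countᵇ (λ x → inV X x ∧ ad X v x ∧ wlEq X i x u)

  wlEq-suc⁻ : ∀ i v w → wlEq X (suc i) v w ≡ true →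
    wlEq X i v w ≡ true × (∀ u → V u ≡ true → classCount i v u ≡ classCount i w u)
  wlEq-suc⁻ i v w e = proj₁ (∧-true e) , λ u vu → ≡ᵇ-true⇒≡ _ _ (lem u vu (allᵇ-elim (proj₂ (∧-true {wlEq X i v w} e)) u))
    where
    lem : ∀ u → V u ≡ true → ∀ {b} → not (V u) ∨ b ≡ true → b ≡ true
    lem u vu h rewrite vu = h

  wlEq-suc⁺ : ∀ i v w → wlEq X i v w ≡ true → (∀ u → V u ≡ true → classCount i v u ≡ classCount i w u) →
    wlEq X (suc i) v w ≡ true
  wlEq-suc⁺ i v w e h = cong₂ _∧_ e (allᵇ-intro lem)
    where
    lem : ∀ u → (not (inV X u) ∨ (classCount i v u ≡ᵇ classCount i w u)) ≡ true
    lem u with V u in vu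
    ... | true  = ≡⇒≡ᵇ-true _ _ (h u vu)
    ... | false = refl

  wlEq-refl : ∀ i v → wlEq X i v v ≡ true
  wlEq-refl zero    v = ≡⇒≡ᵇ-true (col X v) (col X v) refl
  wlEq-refl (suc i) v = wlEq-suc⁺ i v v (wlEq-refl i v) (λ _ _ → refl)

  wlEq-sym : ∀ i v w → wlEq X i v w ≡ true → wlEq X i w v ≡ true
  wlEq-sym zero    v w e = ≡⇒≡ᵇ-true (col X w) (col X v) (sym (≡ᵇ-true⇒≡ (col X v) (col X w) e))
  wlEq-sym (suc i) v w e with wlEq-suc⁻ i v w e
  ... | e′ , h = wlEq-suc⁺ i w v (wlEq-sym i v w e′) (λ u vu → sym (h u vu))

  wlEq-trans : ∀ i u v w → wlEq X i u v ≡ true → wlEq X i v w ≡ true → wlEq X i u w ≡ true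
  wlEq-trans zero u v w e e′ =
    ≡⇒≡ᵇ-true (col X u) (col X w) (trans (≡ᵇ-true⇒≡ (col X u) (col X v) e) (≡ᵇ-true⇒≡ (col X v) (col X w) e′))
  wlEq-trans (suc i) u v w e e′ with wlEq-suc⁻ i u v e | wlEq-suc⁻ i v w e′
  ... | f , h | f′ , h′ = wlEq-suc⁺ i u w (wlEq-trans i u v w f f′) (λ z vz → trans (h z vz) (h′ z vz))

  wlEq⇒col : ∀ i v w → wlEq X i v w ≡ true → col X v ≡ col X w
  wlEq⇒col zero    v w e = ≡ᵇ-true⇒≡ (col X v) (col X w) e
  wlEq⇒col (suc i) v w e = wlEq⇒col i v w (proj₁ (wlEq-suc⁻ i v w e))

  round : ℕ → Fin N → ℕ
  round i v = index (λ x → wlEq X i x v)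

  round⇒wlEq : ∀ i v w → round i v ≡ round i w → wlEq X i v w ≡ true
  round⇒wlEq i v w e with index-common e (v , wlEq-refl i v) (w , wlEq-refl i w)
  ... | x , xv , xw = wlEq-trans i v x w (wlEq-sym i x v xv) xw

  wlEq⇒round : ∀ i v w → wlEq X i v w ≡ true → round i v ≡ round i w
  wlEq⇒round i v w e = index-cong same
    where
    same : ∀ x → wlEq X i x v ≡ wlEq X i x w
    same x = bool-ext (λ xv → wlEq-trans i x v w xv e) (λ xw → wlEq-trans i x w v xw (wlEq-sym i v w e))

  Stable : ℕ → Set
  Stable i = ∀ v w → V v ≡ true → V w ≡ true → wlEq X i v w ≡ true → wlEq X (suc i) v w ≡ true

  -- Stability at `i` makes the classes of rounds `i` and `i + 1` coincide on `V`, so the counts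
  -- deciding the next round do not change.
  stable-suc : ∀ i → Stable i → Stable (suc i)
  stable-suc i st v w vv vw e = wlEq-suc⁺ (suc i) v w e
    (λ u vu → trans (lem v u vu) (trans (proj₂ (wlEq-suc⁻ i v w e) u vu) (sym (lem w u vu))))
    where
    lem : ∀ z u → V u ≡ true → classCount (suc i) z u ≡ classCount i z u
    lem z u vu = countᵇ-cong same
      where
      same : ∀ x → (inV X x ∧ ad X z x ∧ wlEq X (suc i) x u) ≡ (inV X x ∧ ad X z x ∧ wlEq X i x u)
      same x with inV X x in vx
      ... | false = refl
      ... | true  = cong (ad X z x ∧_) (bool-ext (λ e → proj₁ (wlEq-suc⁻ i x u e)) (st x u vx vu))

  private
    open Potential V (λ _ → true)

    -- With every vertex covering and `Z` empty, the redundancy is the number of vertices minus the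
    -- number of colour classes, so it falls whenever a round splits a class.
    classes : ℕ → ℕ
    classes i = redundancy None none? ℕ._≟_ (round i)

  unstable-drop : ∀ i v w → V v ≡ true → V w ≡ true → wlEq X i v w ≡ true → wlEq X (suc i) v w ≢ true → classes (suc i) < classes i
  unstable-drop i v w vv vw e ne = redundancy-strict None none? ℕ._≟_ ℕ._≟_ (round i) (round (suc i))
    (λ x y _ _ h → wlEq⇒round i x y (proj₁ (wlEq-suc⁻ i x y (round⇒wlEq (suc i) x y h))))
    v w (vv , refl) vw (inj₁ refl) (wlEq⇒round i v w e) (λ h → ne (round⇒wlEq (suc i) v w h)) (λ _ _ _ ())

  stable-or-drop : ∀ i → Stable i ⊎ classes (suc i) < classes i
  stable-or-drop i with any? (λ v → any? (λ w → (V v Bool.≟ true) ×-dec (V w Bool.≟ true) ×-dec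
      (wlEq X i v w Bool.≟ true) ×-dec ¬? (wlEq X (suc i) v w Bool.≟ true)))
  ... | yes (v , w , vv , vw , e , ne) = inj₂ (unstable-drop i v w vv vw e ne)
  ... | no none = inj₁ (λ v w vv vw e → decidable-stable (wlEq X (suc i) v w Bool.≟ true) (λ ne → none (v , w , vv , vw , e , ne)))

  -- Each unstable round costs a unit of `classes`, which is at most `N` initially.
  stabilises : ∀ i → Stable i ⊎ classes i + i ≤ N
  stabilises zero = inj₂ (subst (_≤ N) (sym (+-identityʳ (classes 0))) (countᵇ-≤ _))
  stabilises (suc i) with stabilises i | stable-or-drop i
  ... | inj₁ st | _       = inj₁ (stable-suc i st)
  ... | inj₂ _  | inj₁ st = inj₁ (stable-suc i st)
  ... | inj₂ le | inj₂ lt = inj₂ (subst (_≤ N) (sym (+-suc (classes (suc i)) i)) (≤-trans (+-monoˡ-≤ i lt) le))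

  stable-N : Stable N
  stable-N with stabilises N | stable-or-drop N
  ... | inj₁ st | _       = st
  ... | inj₂ _  | inj₁ st = st
  -- Here `classes N` is 0 and cannot fall any further.
  ... | inj₂ le | inj₂ lt = ⊥-elim (n≮0 (≤-trans lt (+-cancelʳ-≤ N (classes N) 0 le)))

  wl : Fin N → ℕ
  wl = round N

  wl-isWL1 : IsWL1Coloring X wl
  wl-isWL1 v w _ _ = mk⇔ (round⇒wlEq N v w) (wlEq⇒round N v w)

  wl-finer : Finer V wl (col X)
  wl-finer x y _ _ e = wlEq⇒col N x y (round⇒wlEq N x y e)

  wl-equitable : Equitable wl
  wl-equitable v w u vv vw vu e = trans (lem v) (trans
    (proj₂ (wlEq-suc⁻ N v w (stable-N v w vv vw (round⇒wlEq N v w e))) u vu) (sym (lem w)))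
    where
    lem : ∀ z → count (nbr? (λ x → wl x ℕ.≟ wl u) z) ≡ classCount N z u
    lem z = countᵇ-cong (λ x → bool-ext (forth x) (back x))
      where
      forth : ∀ x → does (nbr? (λ x → wl x ℕ.≟ wl u) z x) ≡ true → (inV X x ∧ ad X z x ∧ wlEq X N x u) ≡ true
      forth x h with does⇒ (nbr? (λ x → wl x ℕ.≟ wl u) z x) h
      ... | vx , ex , ax = cong₂ _∧_ vx (cong₂ _∧_ ax (round⇒wlEq N x u ex))
      back : ∀ x → (inV X x ∧ ad X z x ∧ wlEq X N x u) ≡ true → does (nbr? (λ x → wl x ℕ.≟ wl u) z x) ≡ true
      back x h with ∧-true {inV X x} h
      ... | vx , h′ with ∧-true {ad X z x} h′
      ...   | ax , ex = dec-true (nbr? (λ x → wl x ℕ.≟ wl u) z x) (vx , wlEq⇒round N x u ex , ax)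

-- Bookkeeping of drops, and coloured graphs without progress.

sum-drop : ∀ {a a′ b b′} i j → a′ + i ≤ a → b′ + j ≤ b → (a′ + b′) + (i + j) ≤ a + b
sum-drop {a} {a′} {b} {b′} i j p q = subst (_≤ a + b) (interchange +-commutativeSemigroup a′ i b′ j) (+-mono-≤ p q)

drop₁ : ∀ {a b} → b < a → b + 1 ≤ a
drop₁ {a} {b} p = subst (_≤ a) (+-comm 1 b) p

drop₂ : ∀ {a b d} → b < a → d < b → d + 2 ≤ a
drop₂ {a} {b} {d} p q = subst (_≤ a) (+-comm 2 d) (≤-trans (s≤s q) p)

drop₃ : ∀ {a b d e} → b < a → d < b → e < d → e + 3 ≤ a
drop₃ {a} {b} {d} {e} p q r = subst (_≤ a) (+-comm 3 e) (≤-trans (s≤s (≤-trans (s≤s r) q)) p)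

-- Serves the pointwise comparison of codegrees; the last implication covers the one case in which
-- the left side is 2.
bit-pair : ∀ {P P′ Q Q′ : Set} (P? : Dec P) (P′? : Dec P′) (Q? : Dec Q) (Q′? : Dec Q′) →
  (P → Q ⊎ Q′) → (P′ → Q ⊎ Q′) → (P → P′ → Q × Q′) →
  bit (does P?) + bit (does P′?) ≤ bit (does Q?) + bit (does Q′?)
bit-pair P? P′? (yes _) (yes _) _ _ _ = bits (does P?) (does P′?)
  where
  bits : ∀ s t → bit s + bit t ≤ 2
  bits true true = ≤-refl
  bits true false = s≤s z≤n
  bits false true = s≤s z≤n
  bits false false = z≤n
bit-pair (no _) (no _) _ _ _ _ _ = z≤n
bit-pair (yes p) (yes p′) (no ¬q) _ _ _ h = ⊥-elim (¬q (proj₁ (h p p′)))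
bit-pair (yes p) (yes p′) (yes _) (no ¬q′) _ _ h = ⊥-elim (¬q′ (proj₂ (h p p′)))
bit-pair (yes p) (no _) (yes _) (no _) _ _ _ = ≤-refl
bit-pair (yes p) (no _) (no _) (yes _) _ _ _ = ≤-refl
bit-pair (no _) (yes p) (yes _) (no _) _ _ _ = ≤-refl
bit-pair (no _) (yes p) (no _) (yes _) _ _ _ = ≤-refl
bit-pair (yes p) (no _) (no ¬q) (no ¬q′) h _ _ with h p
... | inj₁ q = ⊥-elim (¬q q)
... | inj₂ q′ = ⊥-elim (¬q′ q′)
bit-pair (no _) (yes p) (no ¬q) (no ¬q′) _ h _ with h p
... | inj₁ q = ⊥-elim (¬q q)
... | inj₂ q′ = ⊥-elim (¬q′ q′)

≡-stable : {a b : Bool} → ¬ (a ≢ b) → a ≡ b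
≡-stable {a} {b} = decidable-stable (a Bool.≟ b)

_≟²_ : DecidableEquality (ℕ × Bool)
_≟²_ = ≡-dec ℕ._≟_ Bool._≟_

_≟³_ : DecidableEquality ((ℕ × Bool) × Bool)
_≟³_ = ≡-dec _≟²_ Bool._≟_

-- A set of vertices that some flip separates from its complement; the two
-- conditions say that the flip function is well defined and symmetric.
record Split {N : ℕ} (V : Fin N → Bool) (A : Fin N → Fin N → Bool) (c : Fin N → ℕ) (D : Fin N → Set) : Set where
  field
    inhabited : ∃ λ d → V d ≡ true × D d
    proper    : ∃ λ e → V e ≡ true × ¬ D e
    parallel  : ∀ d e d′ e′ → V d ≡ true → V e ≡ true → V d′ ≡ true → V e′ ≡ true →
      D d → ¬ D e → D d′ → ¬ D e′ → c d ≡ c d′ → c e ≡ c e′ → A d e ≡ A d′ e′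
    crossed   : ∀ d e d′ e′ → V d ≡ true → V e ≡ true → V d′ ≡ true → V e′ ≡ true →
      D d → ¬ D e → D d′ → ¬ D e′ → c d ≡ c e′ → c e ≡ c d′ → A d e ≡ A d′ e′

-- A hypothetical counterexample to progress, refuted by `not-stuck`. The colourings `ind u` and
-- `ind₂ u v` stand for the refinements after individualising one or two vertices.
record Stuck {N : ℕ} (V W : Fin N → Bool) (A : Fin N → Fin N → Bool) (c : Fin N → ℕ) : Set₁ where
  open Potential V W
  open Equitability V A
  field
    symm : ∀ x y → V x ≡ true → V y ≡ true → A x y ≡ A y x
    irr  : ∀ x → V x ≡ true → A x x ≡ false
    hom  : ∀ x y x′ y′ → Uncovering x → Uncovering y → Uncovering x′ → Uncovering y′ →
      x ≢ y → x′ ≢ y′ → c x ≡ c x′ → c y ≡ c y′ → A x y ≡ A x′ y′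
    eq   : Equitable c
    vertex : ∃ λ v → V v ≡ true
    other  : ∀ v → ∃ λ w → V w ≡ true × w ≢ v
    ind       : Fin N → Fin N → ℕ
    ind-finer : ∀ u → V u ≡ true → Finer V (ind u) c
    ind-alone : ∀ u → V u ≡ true → ∀ x → V x ≡ true → ind u x ≡ ind u u → x ≡ u
    ind-eq    : ∀ u → V u ≡ true → Equitable (ind u)
    ind₂        : Fin N → Fin N → Fin N → ℕ
    ind₂-finer  : ∀ u v → V u ≡ true → V v ≡ true → Finer V (ind₂ u v) c
    ind₂-aloneˡ : ∀ u v → V u ≡ true → V v ≡ true → ∀ x → V x ≡ true → ind₂ u v x ≡ ind₂ u v u → x ≡ u
    ind₂-aloneʳ : ∀ u v → V u ≡ true → V v ≡ true → ∀ x → V x ≡ true → ind₂ u v x ≡ ind₂ u v v → x ≡ v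
    ind₂-eq     : ∀ u v → V u ≡ true → V v ≡ true → Equitable (ind₂ u v)
    no-gain  : ∀ u → V u ≡ true → ¬ (potential (ind u) + 3 ≤ potential c)
    no-gain₂ : ∀ u v → V u ≡ true → V v ≡ true → ¬ (potential (ind₂ u v) + 6 ≤ potential c)
    no-split : {D : Fin N → Set} → (∀ x → Dec (D x)) → ¬ Split V A c D

module _ {N : ℕ} {V W : Fin N → Bool} {A : Fin N → Fin N → Bool} {c : Fin N → ℕ} (stuck : Stuck V W A c) where

  open Stuck stuck
  open Potential V W
  open Equitability V A
  open Links irr eq using (link-transfer; link-transfer₂; homogeneous-transfer; singleton-adjacency)

  W-cases : ∀ {x} → V x ≡ true → Covering x ⊎ Uncovering x
  W-cases {x} vx with W x
  ... | true  = inj₁ (vx , refl)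
  ... | false = inj₂ (vx , refl)

  disjoint : ∀ {x} → Covering x → ¬ Uncovering x
  disjoint (_ , w) (_ , w′) = true≢false (trans (sym w) w′)

  apart : ∀ {x y} → Covering x → Uncovering y → x ≢ y
  apart cx uy refl = disjoint cx uy

  ind-adj : ∀ u → V u ≡ true → ∀ x y → V x ≡ true → V y ≡ true → ind u x ≡ ind u y → A u x ≡ A u y
  ind-adj u vu x y vx vy e = trans (symm u x vu vx) (trans
    (Links.singleton-adjacency irr (ind-eq u vu) vu (ind-alone u vu) vx vy e) (symm y u vy vu))

  -- Marks `u` without refining. The pair of colour and mark lies between `c` and `ind u`, so that
  -- drops of redundancy can be counted one step at a time.
  at : Fin N → Fin N → Bool
  at u x = does (x ≟ u)

  at-self : ∀ u → at u u ≡ true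
  at-self u = dec-true (u ≟ u) refl

  at-other : ∀ {u x} → x ≢ u → at u x ≡ false
  at-other {u} {x} ne = dec-false (x ≟ u) ne

  ind-finer-at : ∀ u → V u ≡ true → Finer V (ind u) (λ x → c x , at u x)
  ind-finer-at u vu x y vx vy e = cong₂ _,_ (ind-finer u vu x y vx vy e) lem
    where
    lem : at u x ≡ at u y
    lem with x ≟ u | y ≟ u
    ... | yes _    | yes _    = refl
    ... | no _     | no _     = refl
    ... | yes refl | no y≢u   = ⊥-elim (y≢u (ind-alone u vu y vy (sym e)))
    ... | no x≢u   | yes refl = ⊥-elim (x≢u (ind-alone u vu x vx e))

  refine-at : ∀ u {Z : Fin N → Set} (Z? : ∀ x → Dec (Z x)) → Covering u → ¬ Z u → ∀ {b} → V b ≡ true → W b ≡ true ⊎ Z b →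
    b ≢ u → c b ≡ c u → redundancy Z Z? _≟²_ (λ x → c x , at u x) < redundancy Z Z? ℕ._≟_ c
  refine-at u {Z} Z? cu ¬zu {b} vb wzb b≢u e = redundancy-strict Z Z? ℕ._≟_ _≟²_ c (λ x → c x , at u x)
    (λ x y _ _ → cong proj₁) u b cu vb wzb (sym e)
    (λ e′ → true≢false (trans (sym (at-self u)) (trans (cong proj₂ e′) (at-other b≢u)))) free
    where
    free : ∀ x → V x ≡ true → (c x , at u x) ≡ (c u , at u u) → ¬ Z x
    free x vx e′ zx with x ≟ u
    ... | yes refl = ¬zu zx
    ... | no _     = true≢false (trans (sym (at-self u)) (sym (cong proj₂ e′)))

  at-pair : ∀ {u a b} → a ≢ u → b ≢ u → c a ≡ c b → (c a , at u a) ≡ (c b , at u b)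
  at-pair a≢u b≢u e = cong₂ _,_ e (trans (at-other a≢u) (sym (at-other b≢u)))

  -- Individualising a covering vertex that has a covering classmate.

  module Heavy (u u₁ : Fin N) (cu : Covering u) (cu₁ : Covering u₁) (u₁≢u : u₁ ≢ u) (u₁~u : c u₁ ≡ c u) where

    vu = proj₁ cu
    vu₁ = proj₁ cu₁

    private
      k₁ : Fin N → ℕ × Bool
      k₁ x = c x , at u x

      fin₂ = ind-finer-at u vu

      covering-drop : redundancy None none? _≟²_ k₁ < redundancy None none? ℕ._≟_ c
      covering-drop = refine-at u none? cu (λ ()) vu₁ (inj₁ (proj₂ cu₁)) u₁≢u u₁~u

      uncovering-drop : redundancy Uncovering uncovering? _≟²_ k₁ < redundancy Uncovering uncovering? ℕ._≟_ c
      uncovering-drop = refine-at u uncovering? cu (disjoint cu) vu₁ (inj₁ (proj₂ cu₁)) u₁≢u u₁~u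

    -- Marking `u` lowers both redundancies by one. Separating `a` from `b` would lower the first
    -- once more, a forbidden gain of three.
    covering-unrefined : ∀ a b → Covering a → Covering b → a ≢ u → b ≢ u → c a ≡ c b → ind u a ≡ ind u b
    covering-unrefined a b ca cb a≢u b≢u e = decidable-stable (ind u a ℕ.≟ ind u b) λ ne → no-gain u vu
      (sum-drop 2 1
        (drop₂ covering-drop (redundancy-strict None none? _≟²_ ℕ._≟_ k₁ (ind u) fin₂ a b ca (proj₁ cb) (inj₁ (proj₂ cb))
          (at-pair a≢u b≢u e) ne (λ _ _ _ ())))
        (drop₁ (≤-trans (s≤s (redundancy-mono Uncovering uncovering? _≟²_ ℕ._≟_ k₁ (ind u) fin₂)) uncovering-drop)))

    -- Otherwise the class of `a` under `ind u` has lost its uncovering vertices, and the redundancy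
    -- relative to `Uncovering` falls a second time.
    mixed-unseparated : ∀ a b → Covering a → a ≢ u → Uncovering b → c a ≡ c b → ∃ λ b′ → Uncovering b′ × ind u b′ ≡ ind u a
    mixed-unseparated a b ca a≢u ub e with any? (λ b′ → uncovering? b′ ×-dec (ind u b′ ℕ.≟ ind u a))
    ... | yes found = found
    ... | no separated = ⊥-elim (no-gain u vu (sum-drop 1 2
      (drop₁ (≤-trans (s≤s (redundancy-mono None none? _≟²_ ℕ._≟_ k₁ (ind u) fin₂)) covering-drop))
      (drop₂ uncovering-drop (redundancy-strict Uncovering uncovering? _≟²_ ℕ._≟_ k₁ (ind u) fin₂ a b ca (proj₁ ub) (inj₂ ub)
          (at-pair a≢u (λ b≡u → apart cu ub (sym b≡u)) e) (λ e′ → separated (b , ub , sym e′)) (λ x _ e′ ux → separated (x , ux , e′))))))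

    -- Covering classmates other than `u` share a class of `ind u`, which the singleton `y` sees
    -- uniformly. To compare a covering with an uncovering vertex, the former is exchanged for an
    -- uncovering member of its refined class, and `hom` applies.
    singleton-homogeneous : ∀ y → Uncovering y → (∀ x → V x ≡ true → ind u x ≡ ind u y → x ≡ y) →
      ∀ r r′ → V r ≡ true → V r′ ≡ true → r ≢ u → r′ ≢ u → r ≢ y → r′ ≢ y → c r ≡ c r′ → A y r ≡ A y r′
    singleton-homogeneous y uy single r r′ vr vr′ r≢u r′≢u r≢y r′≢y e = go (W-cases vr) (W-cases vr′)
      where
      equal : ∀ s s′ → V s ≡ true → V s′ ≡ true → ind u s ≡ ind u s′ → A y s ≡ A y s′
      equal s s′ vs vs′ e = trans (symm y s (proj₁ uy) vs) (trans
        (Links.singleton-adjacency irr (ind-eq u vu) (proj₁ uy) single vs vs′ e) (symm s′ y vs′ (proj₁ uy)))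
      mixed : ∀ s s′ → Covering s → Uncovering s′ → s ≢ u → s′ ≢ y → c s ≡ c s′ → A y s ≡ A y s′
      mixed s s′ cs us′ s≢u s′≢y e with mixed-unseparated s s′ cs s≢u us′ e
      ... | b , ub , eb = trans (equal s b (proj₁ cs) (proj₁ ub) (sym eb))
        (hom y b y s′ uy ub uy us′ (λ { refl → apart cs uy (single s (proj₁ cs) (sym eb)) }) (λ y≡s′ → s′≢y (sym y≡s′)) refl
          (trans (ind-finer u vu b s (proj₁ ub) (proj₁ cs) eb) e))
      go : Covering r ⊎ Uncovering r → Covering r′ ⊎ Uncovering r′ → A y r ≡ A y r′
      go (inj₁ cr) (inj₁ cr′) = equal r r′ vr vr′ (covering-unrefined r r′ cr cr′ r≢u r′≢u e)
      go (inj₁ cr) (inj₂ ur′) = mixed r r′ cr ur′ r≢u r′≢y e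
      go (inj₂ ur) (inj₁ cr′) = sym (mixed r′ r cr′ ur r′≢u r≢y (sym e))
      go (inj₂ ur) (inj₂ ur′) = hom y r y r′ uy ur uy ur′ (λ y≡r → r≢y (sym y≡r)) (λ y≡r′ → r′≢y (sym y≡r′)) refl e

  -- Mixed classes with two covering vertices.

  module Mixed (u u₁ : Fin N) (cu : Covering u) (cu₁ : Covering u₁) (u₁≢u : u₁ ≢ u) (u₁~u : c u₁ ≡ c u)
               (x₀ : Fin N) (ux₀ : Uncovering x₀) (x₀~u : c x₀ ≡ c u) where

    open Heavy u u₁ cu cu₁ u₁≢u u₁~u

    Witness : Fin N → Fin N → Set
    Witness y a = Covering a × a ≢ u × c a ≡ c y × A u a ≢ A u y

    Deviant : Fin N → Set
    Deviant y = V y ≡ true × y ≢ u × ∃ (Witness y)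

    deviant? : ∀ y → Dec (Deviant y)
    deviant? y = (V y Bool.≟ true) ×-dec ¬? (y ≟ u) ×-dec any? (λ a →
      covering? a ×-dec ¬? (a ≟ u) ×-dec (c a ℕ.≟ c y) ×-dec ¬? (A u a Bool.≟ A u y))

    uniform : ∀ a b → Covering a → Covering b → a ≢ u → b ≢ u → c a ≡ c b → A u a ≡ A u b
    uniform a b ca cb a≢u b≢u e =
      ind-adj u vu a b (proj₁ ca) (proj₁ cb) (covering-unrefined a b ca cb a≢u b≢u e)

    deviant-uncovering : ∀ {y} → Deviant y → Uncovering y
    deviant-uncovering {y} (vy , y≢u , a , ca , a≢u , a~y , ne) with W-cases vy
    ... | inj₂ uy = uy
    ... | inj₁ cy = ⊥-elim (ne (uniform a y ca cy a≢u y≢u a~y))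

    -- `u` treats `b` like `p`, hence like every covering vertex of that class other than `u`, so
    -- `b` is not deviant.
    companion-conforms : ∀ {y p b} → Deviant y → Covering p → p ≢ u → Uncovering b → ind u b ≡ ind u p → b ≢ y
    companion-conforms {y} {p} (vy , _ , a , ca , a≢u , a~y , ne) cp p≢u ub e refl = ne (trans
      (uniform a p ca cp a≢u p≢u (trans a~y (ind-finer u vu y p vy (proj₁ cp) e)))
      (sym (ind-adj u vu y p vy (proj₁ cp) e)))

    deviant-class : ∀ {y r} → Deviant y → V r ≡ true → r ≢ u → c r ≡ c y → A u r ≡ A u y → Deviant r
    deviant-class (vy , _ , a , ca , a≢u , a~y , ne) vr r≢u r~y e =
      vr , r≢u , a , ca , a≢u , trans a~y (sym r~y) , λ e′ → ne (trans e′ e)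

    -- By `hom`, the links of `y` to uncovering vertices in the class of `u` share one value β. A
    -- covering `p` there has an uncovering companion `b` in its refined class; the refined class of
    -- `y` consists of deviant, hence uncovering, vertices, so `b` sees it uniformly, and so does
    -- `p`.
    deviant-links : ∀ {y} (dy : Deviant y) p → V p ≡ true → c p ≡ c u → p ≢ u → p ≢ y →
      A y p ≡ A u (proj₁ (proj₂ (proj₂ dy)))
    deviant-links {y} dy@(vy , y≢u , a , ca , a≢u , a~y , ne) p vp p~u p≢u p≢y =
      trans (constant p vp p~u p≢u p≢y) β≡α
      where
      uy = deviant-uncovering dy

      companion : ∀ p → Covering p → c p ≡ c u → p ≢ u → ∃ λ b → Uncovering b × ind u b ≡ ind u p
      companion p cp p~u p≢u = mixed-unseparated p x₀ cp p≢u ux₀ (trans p~u (sym x₀~u))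

      x₁ = proj₁ (companion u₁ cu₁ u₁~u u₁≢u)
      ux₁ = proj₁ (proj₂ (companion u₁ cu₁ u₁~u u₁≢u))
      ex₁ = proj₂ (proj₂ (companion u₁ cu₁ u₁~u u₁≢u))
      x₁≢y = companion-conforms dy cu₁ u₁≢u ux₁ ex₁
      x₁~u : c x₁ ≡ c u
      x₁~u = trans (ind-finer u vu x₁ u₁ (proj₁ ux₁) vu₁ ex₁) u₁~u

      β = A y x₁

      constant-I : ∀ p → Uncovering p → c p ≡ c u → p ≢ y → A y p ≡ β
      constant-I p up p~u p≢y = hom y p y x₁ uy up uy ux₁ (λ e → p≢y (sym e)) (λ e → x₁≢y (sym e)) refl (trans p~u (sym x₁~u))

      constant : ∀ p → V p ≡ true → c p ≡ c u → p ≢ u → p ≢ y → A y p ≡ β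
      constant p vp p~u p≢u p≢y with W-cases vp
      ... | inj₂ up = constant-I p up p~u p≢y
      ... | inj₁ cp with companion p cp p~u p≢u
      ...   | b , ub , eb = trans (symm y p vy vp) (trans
                (Links.homogeneous-transfer irr (ind-eq u vu) {b} {p} {y} (A b y) (proj₁ ub) vp eb same y vy refl (λ e → p≢y (sym e)))
                (trans (symm b y (proj₁ ub) vy) (constant-I b ub (trans (ind-finer u vu b p (proj₁ ub) vp eb) p~u) b≢y)))
        where
        b≢y = companion-conforms dy cp p≢u ub eb
        same : ∀ r → V r ≡ true → ind u r ≡ ind u y → r ≢ b → A b r ≡ A b y
        same r vr er r≢b = hom b r b y ub ur ub uy (λ e → r≢b (sym e)) b≢y refl r~y
          where
          r~y = ind-finer u vu r y vr vy er
          ur = deviant-uncovering (deviant-class dy vr (λ { refl → y≢u (ind-alone u vu y vy (sym er)) }) r~y (ind-adj u vu r y vr vy er))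

      -- Otherwise β is the value between `u` and `y`, so `y` is linked by β to the whole class of
      -- `u`; then its classmate `a` is linked to `u` by β as well.
      β≡α : β ≡ A u a
      β≡α = ≡-stable λ β≢α → β≢α (sym (flipped β≢α))
        where
        flipped : β ≢ A u a → A u a ≡ β
        flipped β≢α = trans (symm u a vu (proj₁ ca))
          (homogeneous-transfer {y} {a} {u} β vy (proj₁ ca) (sym a~y) all-β u vu refl (λ e → a≢u (sym e)))
          where
          all-β : ∀ r → V r ≡ true → c r ≡ c u → r ≢ y → A y r ≡ β
          all-β r vr r~u r≢y with r ≟ u
          ... | yes refl = trans (symm y u vy vu) (trans (¬-not (λ e → ne (sym e))) (sym (¬-not β≢α)))
          ... | no r≢u = constant r vr r~u r≢u r≢y

    deviant-link-unique : ∀ {y} (dy : Deviant y) p → V p ≡ true → c p ≡ c u → p ≢ y → A y p ≡ A u y → p ≡ u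
    deviant-link-unique {y} dy p vp p~u p≢y e with p ≟ u
    ... | yes p≡u = p≡u
    ... | no p≢u = ⊥-elim (proj₂ (proj₂ (proj₂ (proj₂ (proj₂ (proj₂ dy)))))
            (trans (sym (deviant-links dy p vp p~u p≢u p≢y)) e))

    -- A second such vertex gives `u` two links of value `A u y` into the class of `y`. If that is
    -- the class of `u`, they transfer to `y`, against `deviant-link-unique`. Otherwise they
    -- transfer to `x₀` and end in covering vertices `r` and `r′`, since `x₀` sees the uncovering
    -- ones as it sees `y`. Individualising `r` isolates `x₀`, which then has to see `r′` and `y`
    -- alike.
    deviant-unique : ∀ {y t} → Deviant y → V t ≡ true → t ≢ u → c t ≡ c y → A u t ≡ A u y → t ≡ y
    deviant-unique {y} {t} dy@(vy , y≢u , a , ca , a≢u , a~y , ne) vt t≢u t~y e with t ≟ y | c y ℕ.≟ c u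
    ... | yes t≡y | _ = t≡y
    ... | no t≢y | yes y~u
      with link-transfer₂ {u} {y} {y} {t} (A u y) vu vy (sym y~u) vy y≢u refl vt t≢u e t~y (λ y≡t → t≢y (sym y≡t))
    ...   | r , r′ , r≢r′ , (vr , r~y , r≢y , er) , (vr′ , r′~y , r′≢y , er′) = ⊥-elim (r≢r′ (trans
            (deviant-link-unique dy r vr (trans r~y y~u) r≢y er)
            (sym (deviant-link-unique dy r′ vr′ (trans r′~y y~u) r′≢y er′))))
    deviant-unique {y} {t} dy@(vy , y≢u , a , ca , a≢u , a~y , ne) vt t≢u t~y e | no t≢y | no y≁u
      with link-transfer₂ {u} {x₀} {y} {t} (A u y) vu (proj₁ ux₀) (sym x₀~u) vy y≢u refl vt t≢u e t~y (λ y≡t → t≢y (sym y≡t))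
    ... | r , r′ , r≢r′ , (vr , r~y , r≢x₀ , er) , (vr′ , r′~y , r′≢x₀ , er′) = ⊥-elim (γ≢ (trans (sym er′)
            (Heavy.singleton-homogeneous r r′ cr cr′ (λ e → r≢r′ (sym e)) (trans r′~y (sym r~y)) x₀ ux₀ single
               r′ y vr′ vy (λ e → r≢r′ (sym e)) (λ e → apart cr uy (sym e)) r′≢x₀ (λ e → x₀≢y (sym e)) r′~y)))
      where
      uy = deviant-uncovering dy
      vx₀ = proj₁ ux₀
      x₀≢y : x₀ ≢ y
      x₀≢y refl = y≁u x₀~u
      γ≢ : A u y ≢ A x₀ y
      γ≢ e = ne (sym (trans e (trans (symm x₀ y vx₀ vy) (deviant-links dy x₀ vx₀ x₀~u (λ e → apart cu ux₀ (sym e)) x₀≢y))))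
      is-covering : ∀ s → V s ≡ true → c s ≡ c y → s ≢ x₀ → A x₀ s ≡ A u y → Covering s
      is-covering s vs s~y s≢x₀ es with W-cases vs
      ... | inj₁ cs = cs
      ... | inj₂ us = ⊥-elim (γ≢ (trans (sym es) (hom x₀ s x₀ y ux₀ us ux₀ uy (λ e → s≢x₀ (sym e)) x₀≢y refl s~y)))
      cr = is-covering r vr r~y r≢x₀ er
      cr′ = is-covering r′ vr′ r′~y r′≢x₀ er′
      single : ∀ x → V x ≡ true → ind r x ≡ ind r x₀ → x ≡ x₀
      single x vx ex with x ≟ x₀
      ... | yes x≡x₀ = x≡x₀
      -- A second vertex in the class of `x₀` under `ind r` gives `r`, and hence `y`, two links of
      -- value `A u y` into the class of `u`.
      ... | no x≢x₀ with link-transfer₂ {r} {y} {x₀} {x} (A u y) vr vy r~y vx₀ (λ e → r≢x₀ (sym e)) (trans (symm r x₀ vr vx₀) er)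
               vx (λ { refl → r≢x₀ (sym (ind-alone r vr x₀ vx₀ (sym ex))) })
               (trans (ind-adj r vr x x₀ vx vx₀ ex) (trans (symm r x₀ vr vx₀) er))
               (ind-finer r vr x x₀ vx vx₀ ex) (λ e → x≢x₀ (sym e))
      ...   | p , p′ , p≢p′ , (vp , p~x₀ , p≢y , ep) , (vp′ , p′~x₀ , p′≢y , ep′) = ⊥-elim (p≢p′ (trans
            (deviant-link-unique dy p vp (trans p~x₀ x₀~u) p≢y ep)
            (sym (deviant-link-unique dy p′ vp′ (trans p′~x₀ x₀~u) p′≢y ep′))))

    Side : Fin N → Set
    Side x = x ≡ u ⊎ Deviant x

    side? : ∀ x → Dec (Side x)
    side? x = (x ≟ u) ⊎-dec deviant? x

    conforms : ∀ e → V e ≡ true → ¬ Side e → ∀ a → Covering a → a ≢ u → c a ≡ c e → A u a ≡ A u e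
    conforms e ve ¬se a ca a≢u a~e = ≡-stable λ ne → ¬se (inj₂ (ve , (λ e≡u → ¬se (inj₁ e≡u)) , a , ca , a≢u , a~e , ne))

    -- A class with a covering vertex other than `u` is governed by that vertex. Any other class is
    -- uncovering throughout and differs from that of `u`; `x₀` sees it uniformly by `hom`, and its
    -- classmate `u` inherits this.
    u-uniform : ∀ e e′ → V e ≡ true → V e′ ≡ true → ¬ Side e → ¬ Side e′ → c e ≡ c e′ → A u e ≡ A u e′
    u-uniform e e′ ve ve′ ¬se ¬se′ e~e′ with any? (λ a → covering? a ×-dec ¬? (a ≟ u) ×-dec (c a ℕ.≟ c e))
    ... | yes (a , ca , a≢u , a~e) = trans (sym (conforms e ve ¬se a ca a≢u a~e)) (conforms e′ ve′ ¬se′ a ca a≢u (trans a~e e~e′))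
    ... | no none = trans (from-x₀ e ve refl (λ e≡u → ¬se (inj₁ e≡u))) (sym (from-x₀ e′ ve′ (sym e~e′) (λ e≡u → ¬se′ (inj₁ e≡u))))
      where
      e≁u : c e ≢ c u
      e≁u e~u = none (u₁ , cu₁ , u₁≢u , trans u₁~u (sym e~u))
      uncov : ∀ q → V q ≡ true → c q ≡ c e → Uncovering q
      uncov q vq q~e with W-cases vq
      ... | inj₂ uq = uq
      ... | inj₁ cq = ⊥-elim (none (q , cq , (λ { refl → e≁u (sym q~e) }) , q~e))
      from-x₀ : ∀ r → V r ≡ true → c r ≡ c e → r ≢ u → A u r ≡ A x₀ e
      from-x₀ = homogeneous-transfer {x₀} {u} {e} (A x₀ e) (proj₁ ux₀) vu x₀~u
        (λ q vq q~e q≢x₀ → hom x₀ q x₀ e ux₀ (uncov q vq q~e) ux₀ (uncov e ve refl)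
           (λ e → q≢x₀ (sym e)) (λ { refl → e≁u x₀~u }) refl q~e)

    -- Both values equal the link between `u` and the witness of `y`.
    deviant-u : ∀ {y} → Deviant y → ∀ e f → V e ≡ true → V f ≡ true → ¬ Side e → ¬ Side f → c e ≡ c u → c f ≡ c y → A y e ≡ A u f
    deviant-u {y} dy@(vy , y≢u , a , ca , a≢u , a~y , ne) e f ve vf ¬se ¬sf e~u f~y = trans
      (deviant-links dy e ve e~u (λ e≡u → ¬se (inj₁ e≡u)) (λ { refl → ¬se (inj₂ dy) }))
      (conforms f vf ¬sf a ca a≢u (trans a~y (sym f~y)))

    -- By `deviant-unique`, `y` is alone in its class of `ind u`, hence homogeneous to the class of
    -- `e`; equitability passes this on to the classmates `q` of `y`.
    deviant-elsewhere : ∀ {y} → Deviant y → ∀ e → V e ≡ true → c e ≢ c u → e ≢ y →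
      ∀ q r → V q ≡ true → V r ≡ true → c q ≡ c y → c r ≡ c e → r ≢ q → A q r ≡ A y e
    deviant-elsewhere {y} dy@(vy , y≢u , _) e ve e≁u e≢y q r vq vr q~y r~e r≢q =
      homogeneous-transfer {y} {q} {e} (A y e) vy vq (sym q~y)
        (λ s vs s~e s≢y → singleton-homogeneous y (deviant-uncovering dy) single s e vs ve
           (λ { refl → e≁u (sym s~e) }) (λ { refl → e≁u refl }) s≢y e≢y s~e) r vr r~e r≢q
      where
      single : ∀ x → V x ≡ true → ind u x ≡ ind u y → x ≡ y
      single x vx ex = deviant-unique dy vx (λ { refl → y≢u (ind-alone u vu y vy (sym ex)) })
        (ind-finer u vu x y vx vy ex) (ind-adj u vu x y vx vy ex)

    side-split : Split V A c Side
    side-split = record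
      { inhabited = u , vu , inj₁ refl
      ; proper = u₁ , vu₁ , λ { (inj₁ e) → u₁≢u e ; (inj₂ d) → disjoint cu₁ (deviant-uncovering d) }
      ; parallel = parallel
      ; crossed = crossed
      }
      where
      off : ∀ {d e} → Side d → ¬ Side e → e ≢ d
      off sd ¬se refl = ¬se sd

      parallel : ∀ d e d′ e′ → V d ≡ true → V e ≡ true → V d′ ≡ true → V e′ ≡ true →
        Side d → ¬ Side e → Side d′ → ¬ Side e′ → c d ≡ c d′ → c e ≡ c e′ → A d e ≡ A d′ e′
      parallel d e d′ e′ _ ve _ ve′ (inj₁ refl) ¬se (inj₁ refl) ¬se′ _ e~e′ = u-uniform e e′ ve ve′ ¬se ¬se′ e~e′
      parallel d e y e′ vd ve vy ve′ (inj₁ refl) ¬se (inj₂ dy) ¬se′ d~y e~e′ with c e ℕ.≟ c u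
      ... | yes e~u = sym (deviant-u dy e′ e ve′ ve ¬se′ ¬se (trans (sym e~e′) e~u) (trans e~u d~y))
      ... | no e≁u = deviant-elsewhere dy e′ ve′ (λ e′~u → e≁u (trans e~e′ e′~u)) (off (inj₂ dy) ¬se′) u e vu ve d~y e~e′ (off (inj₁ refl) ¬se)
      parallel y e d′ e′ vy ve vd′ ve′ (inj₂ dy) ¬se (inj₁ refl) ¬se′ y~d e~e′ =
        sym (parallel d′ e′ y e vd′ ve′ vy ve (inj₁ refl) ¬se′ (inj₂ dy) ¬se (sym y~d) (sym e~e′))
      parallel y e y′ e′ vy ve vy′ ve′ (inj₂ dy@(_ , _ , a , ca , a≢u , a~y , ne)) ¬se (inj₂ dy′) ¬se′ y~y′ e~e′ with c e ℕ.≟ c u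
      ... | yes e~u = trans (deviant-u dy e a ve (proj₁ ca) ¬se ¬sa e~u a~y)
                (sym (deviant-u dy′ e′ a ve′ (proj₁ ca) ¬se′ ¬sa (trans (sym e~e′) e~u) (trans a~y y~y′)))
        where
        ¬sa : ¬ Side a
        ¬sa (inj₁ a≡u) = a≢u a≡u
        ¬sa (inj₂ da) = disjoint ca (deviant-uncovering da)
      ... | no e≁u = sym (deviant-elsewhere dy e ve e≁u (off (inj₂ dy) ¬se) y′ e′ vy′ ve′ (sym y~y′) (sym e~e′) (off (inj₂ dy′) ¬se′))

      crossed : ∀ d e d′ e′ → V d ≡ true → V e ≡ true → V d′ ≡ true → V e′ ≡ true →
        Side d → ¬ Side e → Side d′ → ¬ Side e′ → c d ≡ c e′ → c e ≡ c d′ → A d e ≡ A d′ e′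
      crossed d e d′ e′ _ ve _ ve′ (inj₁ refl) ¬se (inj₁ refl) ¬se′ d~e′ e~d′ = u-uniform e e′ ve ve′ ¬se ¬se′ (trans e~d′ d~e′)
      crossed d e y e′ _ ve _ ve′ (inj₁ refl) ¬se (inj₂ dy) ¬se′ d~e′ e~y = sym (deviant-u dy e′ e ve′ ve ¬se′ ¬se (sym d~e′) e~y)
      crossed y e d′ e′ _ ve _ ve′ (inj₂ dy) ¬se (inj₁ refl) ¬se′ y~e′ e~d′ = deviant-u dy e e′ ve ve′ ¬se ¬se′ e~d′ (sym y~e′)
      crossed y e y′ e′ vy ve vy′ ve′ (inj₂ dy) ¬se (inj₂ dy′) ¬se′ y~e′ e~y′ with c e ℕ.≟ c u | c e′ ℕ.≟ c u
      ... | no e≁u | _ = sym (trans (symm y′ e′ vy′ ve′)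
              (deviant-elsewhere dy e ve e≁u (off (inj₂ dy) ¬se) e′ y′ ve′ vy′ (sym y~e′) (sym e~y′) (λ e → off (inj₂ dy′) ¬se′ (sym e))))
      ... | yes _ | no e′≁u = trans (symm y e vy ve)
              (deviant-elsewhere dy′ e′ ve′ e′≁u (off (inj₂ dy′) ¬se′) e y ve vy e~y′ y~e′ (λ e → off (inj₂ dy) ¬se (sym e)))
      -- All four vertices lie in the class of `u`, and both values reduce to links of `u`.
      ... | yes e~u | yes e′~u = trans (deviant-u dy e e′ ve ve′ ¬se ¬se′ e~u (sym y~e′))
              (trans (u-uniform e′ e ve′ ve ¬se′ ¬se (trans e′~u (sym e~u))) (sym (deviant-u dy′ e′ e ve′ ve ¬se′ ¬se e′~u e~y′)))

  heavy-pure : ∀ u u₁ → Covering u → Covering u₁ → u₁ ≢ u → c u₁ ≡ c u → ∀ x → Uncovering x → c x ≢ c u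
  heavy-pure u u₁ cu cu₁ u₁≢u u₁~u x ux x~u = no-split M.side? M.side-split
    where module M = Mixed u u₁ cu cu₁ u₁≢u u₁~u x ux x~u

  point-split : ∀ v → V v ≡ true →
    ¬ (∀ e e′ → V e ≡ true → V e′ ≡ true → e ≢ v → e′ ≢ v → c e ≡ c e′ → A v e ≡ A v e′)
  point-split v vv h = no-split (_≟ v) record
    { inhabited = v , vv , refl
    ; proper = other v
    ; parallel = λ { _ e _ e′ _ ve _ ve′ refl ne refl ne′ _ e~e′ → h e e′ ve ve′ ne ne′ e~e′ }
    ; crossed = λ { _ e _ e′ _ ve _ ve′ refl ne refl ne′ v~e′ e~v → h e e′ ve ve′ ne ne′ (trans e~v v~e′) }
    }

  -- Classes with exactly one covering vertex.

  Light : Fin N → Set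
  Light v = Covering v × (∀ w → Covering w → c w ≡ c v → w ≡ v)

  light? : ∀ v → Dec (Light v)
  light? v = covering? v ×-dec all? (λ w → covering? w →-dec ((c w ℕ.≟ c v) →-dec (w ≟ v)))

  -- Without an uncovering classmate `v` is alone in its class, so it sees every class uniformly and
  -- can be cut off.
  light-partner : ∀ v → Light v → ∃ λ b → Uncovering b × c b ≡ c v
  light-partner v (cv@(vv , _) , single) with any? (λ b → uncovering? b ×-dec (c b ℕ.≟ c v))
  ... | yes found = found
  ... | no none = ⊥-elim (point-split v vv (λ e e′ ve ve′ _ _ e~e′ →
        trans (symm v e vv ve) (trans (singleton-adjacency vv alone ve ve′ e~e′) (symm e′ v ve′ vv))))
    where
    alone : ∀ z → V z ≡ true → c z ≡ c v → z ≡ v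
    alone z vz z~v with W-cases vz
    ... | inj₁ cz = single z cz z~v
    ... | inj₂ uz = ⊥-elim (none (z , uz , z~v))

  -- Marking `v` separates it from its partner, worth one unit. Separating `t` from `t′` splits a
  -- class that is pure by `heavy-pure`, so both redundancies fall: three units in all.
  light-heavy : ∀ v → Light v → ∀ t t′ → Covering t → Covering t′ → c t ≡ c t′ → A v t ≡ A v t′
  light-heavy v lv@(cv@(vv , _) , single) t t′ ct ct′ t~t′ = ≡-stable λ ne →
    let t≢t′ : t ≢ t′
        t≢t′ = λ { refl → ne refl }
        sep : ind v t ≢ ind v t′
        sep e = ne (ind-adj v vv t t′ (proj₁ ct) (proj₁ ct′) e)
        off : ∀ {s s′} → Covering s → Covering s′ → c s ≡ c s′ → s ≢ s′ → s ≢ v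
        off cs cs′ s~s′ s≢s′ s≡v = s≢s′ (trans s≡v (sym (single _ cs′ (trans (sym s~s′) (cong c s≡v)))))
        (b , ub , b~v) = light-partner v lv
        k₁ = λ x → c x , at v x
    in no-gain v vv (sum-drop 1 2
      (drop₁ (redundancy-strict None none? ℕ._≟_ ℕ._≟_ c (ind v) (ind-finer v vv) t t′ ct (proj₁ ct′) (inj₁ (proj₂ ct′)) t~t′ sep (λ _ _ _ ())))
      (drop₂ (refine-at v uncovering? cv (disjoint cv) (proj₁ ub) (inj₂ ub) (λ e → apart cv ub (sym e)) b~v)
        (redundancy-strict Uncovering uncovering? _≟²_ ℕ._≟_ k₁ (ind v) (ind-finer-at v vv) t t′ ct (proj₁ ct′) (inj₁ (proj₂ ct′))
          (at-pair (off ct ct′ t~t′ t≢t′) (off ct′ ct (sym t~t′) (λ e → t≢t′ (sym e))) t~t′) sep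
          (λ x vx e ux → heavy-pure t t′ ct ct′ (λ e → t≢t′ (sym e)) (sym t~t′) x ux (ind-finer v vv x t vx (proj₁ ct) e)))))

  InLight : Fin N → Set
  InLight q = ∃ λ v → Light v × c v ≡ c q

  inLight? : ∀ q → Dec (InLight q)
  inLight? q = any? (λ v → light? v ×-dec (c v ℕ.≟ c q))

  -- Outside the light classes, a class with a covering vertex has at least two and is pure, so
  -- `light-heavy` applies. A class without one is seen uniformly by the partner of `v`, and `v`
  -- inherits this.
  light-uniform : ∀ v → Light v → ∀ e → V e ≡ true → ¬ InLight e → ∀ q → V q ≡ true → c q ≡ c e → q ≢ v → A v q ≡ A v e
  light-uniform v lv@((vv , _) , _) e ve ¬le q vq q~e q≢v with any? (λ t → covering? t ×-dec (c t ℕ.≟ c e))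
  ... | yes (t , ct , t~e) = light-heavy v lv q e (cov q vq q~e) (cov e ve refl) q~e
    where
    cov : ∀ q → V q ≡ true → c q ≡ c e → Covering q
    cov q vq q~e with W-cases vq
    ... | inj₁ cq = cq
    ... | inj₂ uq = ⊥-elim (¬le (t , (ct , λ w cw w~t → decidable-stable (w ≟ t)
            (λ w≢t → heavy-pure t w ct cw w≢t w~t q uq (trans q~e (sym t~e)))) , t~e))
  ... | no none = trans (from-b q vq q~e q≢v) (sym (from-b e ve refl e≢v))
    where
    b = proj₁ (light-partner v lv)
    ub = proj₁ (proj₂ (light-partner v lv))
    b~v = proj₂ (proj₂ (light-partner v lv))
    e≢v : e ≢ v
    e≢v refl = ¬le (v , lv , refl)
    uncov : ∀ q → V q ≡ true → c q ≡ c e → Uncovering q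
    uncov q vq q~e with W-cases vq
    ... | inj₂ uq = uq
    ... | inj₁ cq = ⊥-elim (none (q , cq , q~e))
    from-b : ∀ r → V r ≡ true → c r ≡ c e → r ≢ v → A v r ≡ A b e
    from-b = homogeneous-transfer {b} {v} {e} (A b e) (proj₁ ub) vv b~v
      (λ r vr r~e r≢b → hom b r b e ub (uncov r vr r~e) ub (uncov e ve refl)
        (λ e → r≢b (sym e)) (λ { refl → ¬le (v , lv , sym b~v) }) refl r~e)

  -- The link of `v` to `e` reappears at `e′`, ending in the class of `w`; that of `w` to `e′`
  -- reappears at `e`, ending in the class of `v`. If one of them ends in a covering vertex, this is
  -- `w` or `v` and the values agree; otherwise `hom` compares them.
  light-light : ∀ v w → Light v → Light w → ∀ e e′ → Uncovering e → Uncovering e′ → c e ≡ c w → c e′ ≡ c v → A v e ≡ A w e′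
  light-light v w (cv@(vv , _) , sv) (cw@(vw , _) , sw) e e′ ue@(ve , _) ue′@(ve′ , _) e~w e′~v = ≡-stable contra
    where
    contra : A v e ≢ A w e′ → ⊥
    contra ne with link-transfer {v} {e′} {e} (A v e) vv ve′ (sym e′~v) ve (λ x → apart cv ue (sym x)) refl
                 | link-transfer {w} {e} {e′} (A w e′) vw ve (sym e~w) ve′ (λ x → apart cw ue′ (sym x)) refl
    ... | q , vq , q~e , q≢e′ , aq | r , vr , r~e′ , r≢e , ar with W-cases vq | W-cases vr
    ... | inj₁ cq | _ = ne (trans (sym aq) (trans (cong (A e′) (sw q cq (trans q~e e~w))) (symm e′ w ve′ vw)))
    ... | _ | inj₁ cr = ne (trans (symm v e vv ve) (trans (cong (A e) (sym (sv r cr (trans r~e′ e′~v)))) ar))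
    ... | inj₂ uq | inj₂ ur = ne (trans (sym aq) (trans (symm e′ q ve′ vq)
            (trans (hom q e′ e r uq ue′ ue ur q≢e′ (λ x → r≢e (sym x)) q~e (sym r~e′)) ar)))

  no-light : ∀ v → ¬ Light v
  no-light v lv@((vv , _) , _) with any? (λ e → (V e Bool.≟ true) ×-dec ¬? (inLight? e))
  ... | yes (e , ve , ¬le) = no-split inLight? record
    { inhabited = v , vv , v , lv , refl
    ; proper = e , ve , ¬le
    ; parallel = λ { d e d′ e′ vd ve vd′ ve′ (w , lw , w~d) ¬le ld′ ¬le′ d~d′ e~e′ → trans
        (value w lw e ve ¬le d e vd ve w~d refl (λ { refl → ¬le (w , lw , w~d) }))
        (sym (value w lw e ve ¬le d′ e′ vd′ ve′ (trans w~d d~d′) (sym e~e′) (λ { refl → ¬le′ ld′ }))) }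
    -- `InLight` is a union of classes, so no colour occurs on both sides.
    ; crossed = λ { d e d′ e′ _ _ _ _ (w , lw , w~d) _ _ ¬le′ d~e′ _ → ⊥-elim (¬le′ (w , lw , trans w~d d~e′)) }
    }
    where
    value : ∀ w → Light w → ∀ e → V e ≡ true → ¬ InLight e → ∀ d f → V d ≡ true → V f ≡ true → c w ≡ c d → c f ≡ c e → f ≢ d → A d f ≡ A w e
    value w lw e ve ¬le d f vd vf w~d f~e f≢d = homogeneous-transfer {w} {d} {e} (A w e) (proj₁ (proj₁ lw)) vd w~d
      (λ r vr r~e r≢w → light-uniform w lw e ve ¬le r vr r~e r≢w) f vf f~e f≢d
  ... | no all-light = no-split (λ x → W x Bool.≟ true) record
    { inhabited = v , lv .proj₁
    ; proper = b , proj₁ ub , λ wb → true≢false (trans (sym wb) (proj₂ ub))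
    -- Both links equal the one between the light vertex of the class of `e` and the partner of `d`;
    -- moreover `d` and `d′` coincide.
    ; parallel = λ { d e d′ e′ vd ve vd′ ve′ wd ¬we wd′ ¬we′ d~d′ e~e′ →
        let ld = is-light d vd wd
            (w , lw , w~e) = in-light e ve
            (b , ub , b~d) = light-partner d ld
        in trans (light-light d w ld lw e b (ve , ¬-not ¬we) ub (sym w~e) b~d)
             (trans (sym (light-light d w ld lw e′ b (ve′ , ¬-not ¬we′) ub (trans (sym e~e′) (sym w~e)) b~d))
               (cong (λ z → A z e′) (sym (proj₂ ld d′ (vd′ , wd′) (sym d~d′))))) }
    ; crossed = λ { d e d′ e′ vd ve vd′ ve′ wd ¬we wd′ ¬we′ d~e′ e~d′ →
        light-light d d′ (is-light d vd wd) (is-light d′ vd′ wd′) e e′ (ve , ¬-not ¬we) (ve′ , ¬-not ¬we′) e~d′ (sym d~e′) }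
    }
    where
    b = proj₁ (light-partner v lv)
    ub = proj₁ (proj₂ (light-partner v lv))
    in-light : ∀ x → V x ≡ true → InLight x
    in-light x vx = decidable-stable (inLight? x) (λ ¬lx → all-light (x , vx , ¬lx))
    is-light : ∀ d → V d ≡ true → W d ≡ true → Light d
    is-light d vd wd with in-light d vd
    ... | w , lw , w~d = subst Light (sym (proj₂ lw d (vd , wd) (sym w~d))) lw

  -- Splitting and counting in pure classes.

  pure : ∀ u x → Covering u → Uncovering x → c x ≢ c u
  pure u x cu ux x~u = no-light u (cu , λ w cw w~u → decidable-stable (w ≟ u) (λ w≢u → heavy-pure u w cu cw w≢u w~u x ux x~u))

  heavy : ∀ u → Covering u → ∃ λ u₁ → Covering u₁ × u₁ ≢ u × c u₁ ≡ c u
  heavy u cu with any? (λ w → covering? w ×-dec ¬? (w ≟ u) ×-dec (c w ℕ.≟ c u))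
  ... | yes found = found
  ... | no none = ⊥-elim (no-light u (cu , λ w cw w~u → decidable-stable (w ≟ u) (λ w≢u → none (w , cw , w≢u , w~u))))

  unrefined : ∀ u → Covering u → ∀ a b → Covering a → Covering b → a ≢ u → b ≢ u → c a ≡ c b → ind u a ≡ ind u b
  unrefined u cu with heavy u cu
  ... | u₁ , cu₁ , u₁≢u , u₁~u = Heavy.covering-unrefined u u₁ cu cu₁ u₁≢u u₁~u

  -- The four vertices realise all adjacency patterns to `x` and `y`. Their class is pure, so each
  -- of three successive splits lowers both redundancies, six units in total.
  no-crossing : ∀ x y → V x ≡ true → V y ≡ true → ∀ a b p q → Covering a → Covering b → Covering p → Covering q →
    c b ≡ c a → c p ≡ c a → c q ≡ c a → A x a ≡ true → A x b ≡ true → A x p ≡ false → A x q ≡ false →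
    A y a ≡ true → A y b ≡ false → A y p ≡ true → ¬ A y q ≡ false
  no-crossing x y vx vy a b p q ca cb cp cq b~a p~a q~a xa xb xp xq ya yb yp yq =
    no-gain₂ x y vx vy (sum-drop 3 3 (drop none? (λ _ _ _ ())) (drop uncovering? (λ z _ z~a uz → pure a z ca uz z~a)))
    where
    k₁ : Fin N → ℕ × Bool
    k₁ z = c z , A x z
    k₂ : Fin N → (ℕ × Bool) × Bool
    -- The conjunction splits only the neighbours of `x`; `p` and `q` stay together until the last
    -- step.
    k₂ z = k₁ z , A x z ∧ A y z
    adj-x : ∀ z z′ → V z ≡ true → V z′ ≡ true → ind₂ x y z ≡ ind₂ x y z′ → A x z ≡ A x z′
    adj-x z z′ vz vz′ e = trans (symm x z vx vz) (trans
      (Links.singleton-adjacency irr (ind₂-eq x y vx vy) vx (ind₂-aloneˡ x y vx vy) vz vz′ e) (symm z′ x vz′ vx))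
    adj-y : ∀ z z′ → V z ≡ true → V z′ ≡ true → ind₂ x y z ≡ ind₂ x y z′ → A y z ≡ A y z′
    adj-y z z′ vz vz′ e = trans (symm y z vy vz) (trans
      (Links.singleton-adjacency irr (ind₂-eq x y vx vy) vy (ind₂-aloneʳ x y vx vy) vz vz′ e) (symm z′ y vz′ vy))
    fin₃ : Finer V (ind₂ x y) k₂
    fin₃ z z′ vz vz′ e = cong₂ _,_ (cong₂ _,_ (ind₂-finer x y vx vy z z′ vz vz′ e) (adj-x z z′ vz vz′ e))
      (cong₂ _∧_ (adj-x z z′ vz vz′ e) (adj-y z z′ vz vz′ e))
    differ : ∀ {s t : Bool} → s ≡ true → t ≡ false → s ≢ t
    differ s t e = true≢false (trans (sym s) (trans e t))
    drop : ∀ {Z} (Z? : ∀ z → Dec (Z z)) → (∀ z → V z ≡ true → c z ≡ c a → ¬ Z z) →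
      redundancy Z Z? ℕ._≟_ (ind₂ x y) + 3 ≤ redundancy Z Z? ℕ._≟_ c
    drop {Z} Z? free = drop₃
      (redundancy-strict Z Z? ℕ._≟_ _≟²_ c k₁ (λ _ _ _ _ → cong proj₁) a p ca (proj₁ cp) (inj₁ (proj₂ cp)) (sym p~a)
        (λ e → differ xa xp (cong proj₂ e)) (λ z vz e → free z vz (cong proj₁ e)))
      (redundancy-strict Z Z? _≟²_ _≟³_ k₁ k₂ (λ _ _ _ _ → cong proj₁) a b ca (proj₁ cb) (inj₁ (proj₂ cb)) (cong₂ _,_ (sym b~a) (trans xa (sym xb)))
        (λ e → differ (cong₂ _∧_ xa ya) (cong₂ _∧_ xb yb) (cong proj₂ e)) (λ z vz e → free z vz (cong proj₁ (cong proj₁ e))))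
      (redundancy-strict Z Z? _≟³_ ℕ._≟_ k₂ (ind₂ x y) fin₃ p q cp (proj₁ cq) (inj₁ (proj₂ cq))
        (cong₂ _,_ (cong₂ _,_ (trans p~a (sym q~a)) (trans xp (sym xq))) (trans (cong (_∧ A y p) xp) (sym (cong (_∧ A y q) xq))))
        (λ e → differ yp yq (adj-y p q (proj₁ cp) (proj₁ cq) e))
        (λ z vz e → free z vz (trans (ind₂-finer x y vx vy z p vz (proj₁ cp) e) p~a)))

  -- Splitting two pure classes lowers both redundancies twice, four units where three suffice.
  no-double-split : ∀ x → V x ≡ true → ∀ p p′ r r′ → Covering p → Covering p′ → Covering r → Covering r′ →
    c p′ ≡ c p → c r′ ≡ c r → c r ≢ c p → A x p ≢ A x p′ → A x r ≡ A x r′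
  no-double-split x vx p p′ r r′ cp cp′ cr cr′ p′~p r′~r r≁p ne = ≡-stable λ ne′ → no-gain x vx
    (≤-trans (+-mono-≤ (≤-refl {potential (ind x)}) (s≤s (s≤s (s≤s z≤n))))
      (sum-drop 2 2 (drop ne′ none? (λ _ ())) (drop ne′ uncovering? (λ z uz cs s~z → pure _ z cs uz (sym s~z)))))
    where
    g : Fin N → Bool
    -- Adjacency is recorded inside the class of `p` only, so the class of `r` stays whole until the
    -- second step.
    g z = does (c z ℕ.≟ c p) ∧ A x z
    k₁ : Fin N → ℕ × Bool
    k₁ z = c z , g z
    fin₂ : Finer V (ind x) k₁
    fin₂ z z′ vz vz′ e = cong₂ _,_ (ind-finer x vx z z′ vz vz′ e)
      (cong₂ _∧_ (cong (λ m → does (m ℕ.≟ c p)) (ind-finer x vx z z′ vz vz′ e)) (ind-adj x vx z z′ vz vz′ e))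
    g-in : ∀ z → c z ≡ c p → g z ≡ A x z
    g-in z e = cong (_∧ A x z) (dec-true (c z ℕ.≟ c p) e)
    g-out : ∀ z → c z ≢ c p → g z ≡ false
    g-out z ne = cong (_∧ A x z) (dec-false (c z ℕ.≟ c p) ne)
    drop : A x r ≢ A x r′ → ∀ {Z} (Z? : ∀ z → Dec (Z z)) → (∀ z → Z z → ∀ {s} → Covering s → c s ≢ c z) →
      redundancy Z Z? ℕ._≟_ (ind x) + 2 ≤ redundancy Z Z? ℕ._≟_ c
    drop ne′ {Z} Z? free = drop₂
      (redundancy-strict Z Z? ℕ._≟_ _≟²_ c k₁ (λ _ _ _ _ → cong proj₁) p p′ cp (proj₁ cp′) (inj₁ (proj₂ cp′)) (sym p′~p)
        (λ e → ne (trans (sym (g-in p refl)) (trans (cong proj₂ e) (g-in p′ p′~p)))) (λ z vz e zz → free z zz cp (sym (cong proj₁ e))))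
      (redundancy-strict Z Z? _≟²_ ℕ._≟_ k₁ (ind x) fin₂ r r′ cr (proj₁ cr′) (inj₁ (proj₂ cr′))
        (cong₂ _,_ (sym r′~r) (trans (g-out r r≁p) (sym (g-out r′ (λ e → r≁p (trans (sym r′~r) e))))))
        (λ e → ne′ (ind-adj x vx r r′ (proj₁ cr) (proj₁ cr′) e))
        (λ z vz e zz → free z zz cr (sym (ind-finer x vx z r vz (proj₁ cr) e))))

  -- All pairs of covering classmates have equally many common neighbours in the class
  -- of x, so (y_a - y_q)(y_b - y_p), with y_v = 1 iff y ~ v, sums to 0 over the class.
  -- The summand is 1 at x, and a summand -1 is a crossing with x.
  no-two-two : ∀ x → Uncovering x → ∀ a b p q → Covering a → Covering b → Covering p → Covering q →
    c b ≡ c a → c p ≡ c a → c q ≡ c a → a ≢ b → p ≢ q →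
    A x a ≡ true → A x b ≡ true → A x p ≡ false → ¬ A x q ≡ false
  no-two-two x ux@(vx , _) a b p q ca cb cp cq b~a p~a q~a a≢b p≢q xa xb xp xq =
    <-irrefl (cong₂ _+_ (sym ab≡ap) (sym qp≡qb)) strict
    where
    differ : ∀ {s t} → A x s ≡ true → A x t ≡ false → s ≢ t
    differ xs xt refl = true≢false (trans (sym xs) xt)
    common? : ∀ s t y → Dec (V y ≡ true × (c y ≡ c x × A s y ≡ true) × A t y ≡ true)
    common? s t = nbr? (λ y → (c y ℕ.≟ c x) ×-dec (A s y Bool.≟ true)) t
    codegree : ∀ s t t′ → Covering s → Covering t → Covering t′ → t ≢ s → t′ ≢ s → c t ≡ c t′ →
      count (common? s t) ≡ count (common? s t′)
    -- Under `ind s` the vertices `t` and `t′` share a class, and the neighbours of `s` in the class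
    -- of `x` form a union of classes.
    codegree s t t′ cs ct ct′ t≢s t′≢s t~t′ = nbr-count (ind-eq s (proj₁ cs)) (λ y → (c y ℕ.≟ c x) ×-dec (A s y Bool.≟ true))
      (λ y z vy vz e (y~x , sy) → trans (ind-finer s (proj₁ cs) z y vz vy (sym e)) y~x , trans (sym (ind-adj s (proj₁ cs) y z vy vz e)) sy)
      (proj₁ ct) (proj₁ ct′) (unrefined s cs t t′ ct ct′ t≢s t′≢s t~t′)
    ab≡ap : count (common? a b) ≡ count (common? a p)
    ab≡ap = codegree a b p ca cb cp (λ e → a≢b (sym e)) (λ e → differ xa xp (sym e)) (trans b~a (sym p~a))
    qp≡qb : count (common? q p) ≡ count (common? q b)
    qp≡qb = codegree q p b cq cp cb p≢q (differ xb xq) (trans p~a (sym b~a))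
    flipped : ∀ {s y t} → V s ≡ true → V y ≡ true → A s y ≡ t → A y s ≡ t
    flipped {s} {y} vs vy e = trans (symm y s vy vs) e
    pointwise : ∀ y → bit (does (common? a p y)) + bit (does (common? q b y)) ≤ bit (does (common? a b y)) + bit (does (common? q p y))
    pointwise y = bit-pair (common? a p y) (common? q b y) (common? a b y) (common? q p y) one two
      (λ { (vy , (y~x , ay) , py) (_ , (_ , qy) , by) → (vy , (y~x , ay) , by) , (vy , (y~x , qy) , py) })
      where
      one : (V y ≡ true × (c y ≡ c x × A a y ≡ true) × A p y ≡ true) →
        (V y ≡ true × (c y ≡ c x × A a y ≡ true) × A b y ≡ true) ⊎ (V y ≡ true × (c y ≡ c x × A q y ≡ true) × A p y ≡ true)
      one (vy , (y~x , ay) , py) with A b y Bool.≟ true | A q y Bool.≟ true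
      ... | yes by | _ = inj₁ (vy , (y~x , ay) , by)
      ... | _ | yes qy = inj₂ (vy , (y~x , qy) , py)
      ... | no by | no qy = ⊥-elim (no-crossing x y vx vy a b p q ca cb cp cq b~a p~a q~a xa xb xp xq
              (flipped (proj₁ ca) vy ay) (flipped (proj₁ cb) vy (¬-not by)) (flipped (proj₁ cp) vy py) (flipped (proj₁ cq) vy (¬-not qy)))
      two : (V y ≡ true × (c y ≡ c x × A q y ≡ true) × A b y ≡ true) →
        (V y ≡ true × (c y ≡ c x × A a y ≡ true) × A b y ≡ true) ⊎ (V y ≡ true × (c y ≡ c x × A q y ≡ true) × A p y ≡ true)
      two (vy , (y~x , qy) , by) with A a y Bool.≟ true | A p y Bool.≟ true
      ... | yes ay | _ = inj₁ (vy , (y~x , ay) , by)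
      ... | _ | yes py = inj₂ (vy , (y~x , qy) , py)
      ... | no ay | no py = ⊥-elim (no-crossing x y vx vy b a q p cb ca cq cp (sym b~a) (trans q~a (sym b~a)) (trans p~a (sym b~a)) xb xa xq xp
              (flipped (proj₁ cb) vy by) (flipped (proj₁ ca) vy (¬-not ay)) (flipped (proj₁ cq) vy qy) (flipped (proj₁ cp) vy (¬-not py)))
    at-x : bit (does (common? a p x)) + bit (does (common? q b x)) < bit (does (common? a b x)) + bit (does (common? q p x))
    at-x rewrite dec-false (common? a p x) (λ (_ , _ , px) → true≢false (trans (sym px) (flipped vx (proj₁ cp) xp)))
               | dec-false (common? q b x) (λ (_ , (_ , qx) , _) → true≢false (trans (sym qx) (flipped vx (proj₁ cq) xq)))
               | dec-true (common? a b x) (vx , (refl , flipped vx (proj₁ ca) xa) , flipped vx (proj₁ cb) xb) = s≤s z≤n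
    strict : count (common? a p) + count (common? q b) < count (common? a b) + count (common? q p)
    strict = countᵇ-pair-strict pointwise x at-x

  -- Cutting off a covering vertex of a pure class.

  module Pure (u : Fin N) (cu : Covering u) where

    vu = proj₁ cu
    u₁ = proj₁ (heavy u cu)
    cu₁ = proj₁ (proj₂ (heavy u cu))
    u₁≢u = proj₁ (proj₂ (proj₂ (heavy u cu)))
    u₁~u = proj₂ (proj₂ (proj₂ (heavy u cu)))

    covering-class : ∀ w s → Covering s → V w ≡ true → c w ≡ c s → Covering w
    covering-class w s cs vw w~s with W-cases vw
    ... | inj₁ cw = cw
    ... | inj₂ uw = ⊥-elim (pure s w cs uw w~s)

    Neighbour : Fin N → Fin N → Set
    Neighbour x a = V a ≡ true × c a ≡ c u × a ≢ x × A x a ≡ true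

    -- By `no-two-two`, an uncovering vertex with two neighbours in the class of `u` misses at most
    -- one vertex there. So for uncovering `x`, `μ x` is the value taken on all but at most one
    -- vertex of that class; it depends on the colour alone by equitability.
    Majority : Fin N → Set
    Majority x = ∃ λ a → ∃ λ b → a ≢ b × Neighbour x a × Neighbour x b

    majority? : ∀ x → Dec (Majority x)
    majority? x = any? (λ a → any? (λ b → ¬? (a ≟ b) ×-dec neighbour? a ×-dec neighbour? b))
      where
      neighbour? : ∀ a → Dec (Neighbour x a)
      neighbour? a = (V a Bool.≟ true) ×-dec (c a ℕ.≟ c u) ×-dec ¬? (a ≟ x) ×-dec (A x a Bool.≟ true)

    μ : Fin N → Bool
    μ x = does (majority? x)

    majority-transfer : ∀ x y → V x ≡ true → V y ≡ true → c x ≡ c y → Majority x → Majority y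
    majority-transfer x y vx vy x~y (a , b , a≢b , (va , a~u , a≢x , xa) , (vb , b~u , b≢x , xb)) =
      let (r , s , r≢s , (vr , r~a , r≢y , yr) , (vs , s~a , s≢y , ys)) =
            link-transfer₂ {x} {y} {a} {b} true vx vy x~y va a≢x xa vb b≢x xb (trans b~u (sym a~u)) a≢b
      in r , s , r≢s , (vr , trans r~a a~u , r≢y , yr) , (vs , trans s~a a~u , s≢y , ys)

    μ-class : ∀ x y → V x ≡ true → V y ≡ true → c x ≡ c y → μ x ≡ μ y
    μ-class x y vx vy x~y with majority? x | majority? y
    ... | yes _ | yes _ = refl
    ... | no _  | no _  = refl
    ... | yes m | no ¬m = ⊥-elim (¬m (majority-transfer x y vx vy x~y m))
    ... | no ¬m | yes m = ⊥-elim (¬m (majority-transfer y x vy vx (sym x~y) m))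

    Attached : Fin N → Set
    Attached x = Uncovering x × A x u ≢ μ x

    -- `u` is already the exception of `x` in this class, and a second one is impossible.
    attached-elsewhere : ∀ x → Attached x → ∀ w → V w ≡ true → c w ≡ c u → w ≢ u → A x w ≡ μ x
    attached-elsewhere x (ux , ne) w vw w~u w≢u = go (majority? x) ne
      where
      cw = covering-class w u cu vw w~u
      go : (m : Dec (Majority x)) → A x u ≢ does m → A x w ≡ does m
      go (yes (a , b , a≢b , (va , a~u , _ , xa) , (vb , b~u , _ , xb))) ne = ≡-stable λ ne′ →
        no-two-two x ux a b u w (covering-class a u cu va a~u) (covering-class b u cu vb b~u) cu cw
          (trans b~u (sym a~u)) (sym a~u) (trans w~u (sym a~u)) a≢b (λ e → w≢u (sym e)) xa xb (¬-not ne) (¬-not ne′)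
      go (no ¬m) ne = ≡-stable λ ne′ → ¬m (u , w , (λ e → w≢u (sym e)) , (vu , refl , apart cu ux , ¬-not ne) , (vw , w~u , apart cw ux , ¬-not ne′))

    Side : Fin N → Set
    Side x = x ≡ u ⊎ Attached x

    side? : ∀ x → Dec (Side x)
    side? x = (x ≟ u) ⊎-dec (uncovering? x ×-dec ¬? (A x u Bool.≟ μ x))

    u-value : ∀ y → Uncovering y → ¬ Side y → A u y ≡ μ y
    u-value y uy ¬sy = trans (symm u y vu (proj₁ uy)) (≡-stable λ ne → ¬sy (inj₂ (uy , ne)))

    -- `x` already separates `u` from `u₁`, so by `no-double-split` it cannot split another class of
    -- covering vertices.
    attached-constant : ∀ x → Attached x → ∀ r → Covering r → c r ≢ c u → ∀ s → Covering s → c s ≡ c r → A x s ≡ A x r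
    attached-constant x ax@(ux , ne) r cr r≁u s cs s~r = no-double-split x (proj₁ ux) u u₁ s r cu cu₁ cs cr u₁~u (sym s~r)
      (λ s~u → r≁u (trans (sym s~r) s~u)) (λ e → ne (trans e (attached-elsewhere x ax u₁ (proj₁ cu₁) u₁~u u₁≢u)))

    side-split : Split V A c Side
    side-split = record
      { inhabited = u , vu , inj₁ refl
      ; proper = u₁ , proj₁ cu₁ , λ { (inj₁ e) → u₁≢u e ; (inj₂ (ux , _)) → disjoint cu₁ ux }
      ; parallel = parallel
      ; crossed = crossed
      }
      where
      off : ∀ {d e} → Side d → ¬ Side e → d ≢ e
      off sd ¬se refl = ¬se sd

      u-uniform : ∀ e e′ → V e ≡ true → V e′ ≡ true → ¬ Side e → ¬ Side e′ → c e ≡ c e′ → A u e ≡ A u e′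
      u-uniform e e′ ve ve′ ¬se ¬se′ e~e′ with W-cases ve
      ... | inj₂ ue = trans (u-value e ue ¬se) (trans (μ-class e e′ ve ve′ e~e′) (sym (u-value e′ ue′ ¬se′)))
        where
        ue′ : Uncovering e′
        ue′ with W-cases ve′
        ... | inj₂ ue′ = ue′
        ... | inj₁ ce′ = ⊥-elim (pure e′ e ce′ ue e~e′)
      ... | inj₁ ce = ind-adj u vu e e′ ve ve′ (unrefined u cu e e′ ce (covering-class e′ e ce ve′ (sym e~e′))
              (λ e≡u → ¬se (inj₁ e≡u)) (λ e≡u → ¬se′ (inj₁ e≡u)) e~e′)

      x-uniform : ∀ x x′ → Attached x → Attached x′ → c x ≡ c x′ → ∀ e e′ → V e ≡ true → V e′ ≡ true → ¬ Side e → ¬ Side e′ → c e ≡ c e′ → A x e ≡ A x′ e′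
      x-uniform x x′ ax@(ux , _) ax′@(ux′ , _) x~x′ e e′ ve ve′ ¬se ¬se′ e~e′ with W-cases ve | W-cases ve′ | c e ℕ.≟ c u
      ... | inj₂ ue | inj₂ ue′ | _ = hom x e x′ e′ ux ue ux′ ue′ (off (inj₂ ax) ¬se) (off (inj₂ ax′) ¬se′) x~x′ e~e′
      ... | inj₁ ce | inj₂ ue′ | _ = ⊥-elim (pure e e′ ce ue′ (sym e~e′))
      ... | inj₂ ue | inj₁ ce′ | _ = ⊥-elim (pure e′ e ce′ ue e~e′)
      ... | inj₁ ce | inj₁ ce′ | yes e~u = trans (attached-elsewhere x ax e ve e~u (λ e≡u → ¬se (inj₁ e≡u)))
              (trans (μ-class x x′ (proj₁ ux) (proj₁ ux′) x~x′)
                (sym (attached-elsewhere x′ ax′ e′ ve′ (trans (sym e~e′) e~u) (λ e≡u → ¬se′ (inj₁ e≡u)))))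
      ... | inj₁ ce | inj₁ ce′ | no e≁u = sym (homogeneous-transfer {x} {x′} {e} (A x e) (proj₁ ux) (proj₁ ux′) x~x′
              (λ r vr r~e _ → attached-constant x ax e ce e≁u r (covering-class r e ce vr r~e) r~e) e′ ve′ (sym e~e′)
              (apart ce′ ux′))

      parallel : ∀ d e d′ e′ → V d ≡ true → V e ≡ true → V d′ ≡ true → V e′ ≡ true →
        Side d → ¬ Side e → Side d′ → ¬ Side e′ → c d ≡ c d′ → c e ≡ c e′ → A d e ≡ A d′ e′
      parallel d e d′ e′ _ ve _ ve′ (inj₁ refl) ¬se (inj₁ refl) ¬se′ _ e~e′ = u-uniform e e′ ve ve′ ¬se ¬se′ e~e′
      parallel d e d′ e′ _ _ _ _ (inj₁ refl) _ (inj₂ (ux , _)) _ d~d′ _ = ⊥-elim (pure u d′ cu ux (sym d~d′))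
      parallel d e d′ e′ _ _ _ _ (inj₂ (ux , _)) _ (inj₁ refl) _ d~d′ _ = ⊥-elim (pure u d cu ux d~d′)
      parallel d e d′ e′ _ ve _ ve′ (inj₂ ad) ¬se (inj₂ ad′) ¬se′ d~d′ e~e′ = x-uniform d d′ ad ad′ d~d′ e e′ ve ve′ ¬se ¬se′ e~e′

      -- Both links equal `μ x`: `y` is not attached and shares the colour of `x`, whose only
      -- exception is `u`.
      mixed : ∀ x y w → Attached x → V y ≡ true → ¬ Side y → c y ≡ c x → V w ≡ true → ¬ Side w → c w ≡ c u → A u y ≡ A x w
      mixed x y w ax@(ux , _) vy ¬sy y~x vw ¬sw w~u with W-cases vy
      ... | inj₁ cy = ⊥-elim (pure y x cy ux (sym y~x))
      ... | inj₂ uy = trans (u-value y uy ¬sy) (trans (μ-class y x vy (proj₁ ux) y~x)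
              (sym (attached-elsewhere x ax w vw w~u (λ w≡u → ¬sw (inj₁ w≡u)))))

      crossed : ∀ d e d′ e′ → V d ≡ true → V e ≡ true → V d′ ≡ true → V e′ ≡ true →
        Side d → ¬ Side e → Side d′ → ¬ Side e′ → c d ≡ c e′ → c e ≡ c d′ → A d e ≡ A d′ e′
      crossed d e d′ e′ _ ve _ ve′ (inj₁ refl) ¬se (inj₁ refl) ¬se′ d~e′ e~d′ = u-uniform e e′ ve ve′ ¬se ¬se′ (trans e~d′ d~e′)
      crossed d e d′ e′ _ ve _ ve′ (inj₁ refl) ¬se (inj₂ ad′) ¬se′ d~e′ e~d′ = mixed d′ e e′ ad′ ve ¬se e~d′ ve′ ¬se′ (sym d~e′)
      crossed d e d′ e′ _ ve _ ve′ (inj₂ ad) ¬se (inj₁ refl) ¬se′ d~e′ e~d′ = sym (mixed d e′ e ad ve′ ¬se′ (sym d~e′) ve ¬se e~d′)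
      crossed d e d′ e′ _ ve _ ve′ (inj₂ ad@(ud , _)) ¬se (inj₂ ad′@(ud′ , _)) ¬se′ d~e′ e~d′ with W-cases ve | W-cases ve′
      ... | inj₁ ce | _ = ⊥-elim (pure e d′ ce ud′ (sym e~d′))
      ... | _ | inj₁ ce′ = ⊥-elim (pure e′ d ce′ ud d~e′)
      ... | inj₂ ue | inj₂ ue′ = trans (hom d e e′ d′ ud ue ue′ ud′ (off (inj₂ ad) ¬se) (λ x → off (inj₂ ad′) ¬se′ (sym x)) d~e′ e~d′)
              (symm e′ d′ ve′ (proj₁ ud′))

  not-stuck : ⊥
  not-stuck with any? covering?
  ... | yes (u , cu) = no-split (Pure.side? u cu) (Pure.side-split u cu)
  -- Without covering vertices `hom` governs all adjacency, so any vertex can be cut off.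
  ... | no none = point-split v vv (λ e e′ ve ve′ e≢v e′≢v e~e′ →
        hom v e v e′ (uncov v vv) (uncov e ve) (uncov v vv) (uncov e′ ve′) (λ x → e≢v (sym x)) (λ x → e′≢v (sym x)) refl e~e′)
    where
    v = proj₁ vertex
    vv = proj₂ vertex
    uncov : ∀ x → V x ≡ true → Uncovering x
    uncov x vx with W-cases vx
    ... | inj₂ ux = ux
    ... | inj₁ cx = ⊥-elim (none (x , cx))

-- Individualisation and the search for splits.

anyᵇ-elim : {p : Fin n → Bool} → anyᵇ p ≡ true → ∃ λ x → p x ≡ true
anyᵇ-elim {suc n} {p} e with p zero in e₀
... | true  = zero , e₀
... | false with anyᵇ-elim e
...   | x , px = suc x , px

∨-true : ∀ {a b} → a ∨ b ≡ true → a ≡ true ⊎ b ≡ true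
∨-true {true}  _ = inj₁ refl
∨-true {false} e = inj₂ e

-- The sum of all colours plus one serves as the fresh colour.
individualise : Fin N → (Fin N → ℕ) → Fin N → ℕ
individualise u k x = if does (x ≟ u) then suc (total k) else k x

individualise-self : ∀ (u : Fin N) k → individualise u k u ≡ suc (total k)
individualise-self u k rewrite dec-true (u ≟ u) refl = refl

individualise-other : ∀ (u : Fin N) k {x} → x ≢ u → individualise u k x ≡ k x
individualise-other u k {x} ne rewrite dec-false (x ≟ u) ne = refl

individualise-fresh : ∀ (u : Fin N) k x → individualise u k u ≢ k x
individualise-fresh u k x e = <-irrefl (trans (sym e) (individualise-self u k)) (s≤s (≤-total-sum k x))

individualise-alone : ∀ (u : Fin N) k x → individualise u k x ≡ individualise u k u → x ≡ u
individualise-alone u k x e = decidable-stable (x ≟ u)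
  (λ ne → individualise-fresh u k x (trans (sym e) (individualise-other u k ne)))

individualise-finer : ∀ (u : Fin N) k x y → individualise u k x ≡ individualise u k y → k x ≡ k y
individualise-finer u k x y e with y ≟ u
... | yes refl = cong k (individualise-alone u k x (trans e (sym (individualise-self u k))))
... | no y≢u with x ≟ u
...   | yes refl = ⊥-elim (<-irrefl (sym e) (s≤s (≤-total-sum k y)))
...   | no _     = e

module _ (V : Fin N → Bool) (A : Fin N → Fin N → Bool) (c : Fin N → ℕ) where

  split-cong : {D E : Fin N → Set} → (∀ x → D x → E x) → (∀ x → E x → D x) → Split V A c D → Split V A c E
  split-cong f g s = record
    { inhabited = let (d , vd , dd) = inhabited in d , vd , f d dd
    ; proper    = let (e , ve , ¬de) = proper in e , ve , λ ee → ¬de (g e ee)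
    ; parallel  = λ d e d′ e′ vd ve vd′ ve′ dd ¬ee dd′ ¬ee′ →
        parallel d e d′ e′ vd ve vd′ ve′ (g d dd) (λ x → ¬ee (f e x)) (g d′ dd′) (λ x → ¬ee′ (f e′ x))
    ; crossed   = λ d e d′ e′ vd ve vd′ ve′ dd ¬ee dd′ ¬ee′ →
        crossed d e d′ e′ vd ve vd′ ve′ (g d dd) (λ x → ¬ee (f e x)) (g d′ dd′) (λ x → ¬ee′ (f e′ x))
    }
    where open Split s

  module _ {D : Fin N → Set} (D? : ∀ x → Dec (D x)) where

    private
      under? : {R : Fin N → Fin N → Fin N → Fin N → Set} → (∀ d e d′ e′ → Dec (R d e d′ e′)) →
        Dec (∀ d e d′ e′ → V d ≡ true → V e ≡ true → V d′ ≡ true → V e′ ≡ true → D d → ¬ D e → D d′ → ¬ D e′ → R d e d′ e′)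
      under? R? = all? (λ d → all? (λ e → all? (λ d′ → all? (λ e′ →
        (V d Bool.≟ true) →-dec (V e Bool.≟ true) →-dec (V d′ Bool.≟ true) →-dec (V e′ Bool.≟ true) →-dec
        D? d →-dec ¬? (D? e) →-dec D? d′ →-dec ¬? (D? e′) →-dec R? d e d′ e′))))

    split? : Dec (Split V A c D)
    split? = map′ (λ { (i , p , q , r) → record { inhabited = i ; proper = p ; parallel = q ; crossed = r } })
      (λ s → let open Split s in inhabited , proper , parallel , crossed)
      (any? (λ d → (V d Bool.≟ true) ×-dec D? d) ×-dec any? (λ e → (V e Bool.≟ true) ×-dec ¬? (D? e)) ×-dec
       under? (λ d e d′ e′ → (c d ℕ.≟ c d′) →-dec (c e ℕ.≟ c e′) →-dec (A d e Bool.≟ A d′ e′)) ×-dec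
       under? (λ d e d′ e′ → (c d ℕ.≟ c e′) →-dec (c e ℕ.≟ c d′) →-dec (A d e Bool.≟ A d′ e′)))

  Member : Subset N → Fin N → Set
  Member s x = lookup s x ≡ true

  anySplit? : Dec (∃ λ s → Split V A c (Member s))
  anySplit? = anySubset? (λ s → split? (λ x → lookup s x Bool.≟ true))

  unsplittable : ¬ (∃ λ s → Split V A c (Member s)) → {D : Fin N → Set} → (∀ x → Dec (D x)) → ¬ Split V A c D
  unsplittable none D? s = none (tabulate (does ∘ D?) , split-cong
    (λ x dx → trans (lookup∘tabulate (does ∘ D?) x) (dec-true (D? x) dx))
    (λ x e → does⇒ (D? x) (trans (sym (lookup∘tabulate (does ∘ D?) x)) e)) s)

record Admissible {N : ℕ} (W : Fin N → Bool) (X : CGraph N) : Set where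
  open Potential (inV X) W
  field
    symm : ∀ x y → inV X x ≡ true → inV X y ≡ true → ad X x y ≡ ad X y x
    irr  : ∀ x → inV X x ≡ true → ad X x x ≡ false
    hom  : ∀ x y x′ y′ → Uncovering x → Uncovering y → Uncovering x′ → Uncovering y′ →
      x ≢ y → x′ ≢ y′ → col X x ≡ col X x′ → col X y ≡ col X y′ → ad X x y ≡ ad X x′ y′
    vertex : ∃ λ v → inV X v ≡ true

potential-restrict : {V V′ : Fin N → Bool} (W : Fin N → Bool) (k : Fin N → ℕ) → (∀ x → V′ x ≡ true → V x ≡ true) →
  Potential.potential V′ W k ≤ Potential.potential V W k
potential-restrict {V = V} {V′} W k sub = +-mono-≤ (lem P′.none? P.none? (λ _ ())) (lem P′.uncovering? P.uncovering? (λ { x (v , w) → sub x v , w }))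
  where
  module P = Potential V W
  module P′ = Potential V′ W
  lem : ∀ {Z Z′} (Z′? : ∀ x → Dec (Z′ x)) (Z? : ∀ x → Dec (Z x)) → (∀ x → Z′ x → Z x) → P′.redundancy Z′ Z′? ℕ._≟_ k ≤ P.redundancy Z Z? ℕ._≟_ k
  lem {Z} {Z′} Z′? Z? f = count-mono (P′.redundant? Z′ Z′? ℕ._≟_ k) (P.redundant? Z Z? ℕ._≟_ k) imp
    where
    imp : ∀ w → P′.Redundant Z′ Z′? ℕ._≟_ k w → P.Redundant Z Z? ℕ._≟_ k w
    imp w ((vw , ww) , x , vx , inj₁ z , e) = (sub w vw , ww) , x , sub x vx , inj₁ (f x z) , e
    imp w ((vw , ww) , x , vx , inj₂ h , e) = (sub w vw , ww) , x , sub x vx , inj₂ h , e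

-- The disconnecting flip and its components.

module Disconnect {N : ℕ} (W : Fin N → Bool) (X : CGraph N) (adm : Admissible W X)
                  (s : Subset N) (split : Split (inV X) (ad X) (col X) (λ x → lookup s x ≡ true)) where

  open Admissible adm
  open Split split

  private
    V = inV X
    D : Fin N → Set
    D x = lookup s x ≡ true
    D? : ∀ x → Dec (D x)
    D? x = lookup s x Bool.≟ true

  -- The flip acts on the colour pairs of edges leaving `D`; admitting both orders makes it
  -- symmetric.
  Cut : ℕ → ℕ → Set
  Cut a b = ∃ λ d → ∃ λ e → V d ≡ true × V e ≡ true × D d × ¬ D e × ad X d e ≡ true ×
    ((col X d ≡ a × col X e ≡ b) ⊎ (col X d ≡ b × col X e ≡ a))

  cut? : ∀ a b → Dec (Cut a b)
  cut? a b = any? (λ d → any? (λ e → (V d Bool.≟ true) ×-dec (V e Bool.≟ true) ×-dec D? d ×-dec ¬? (D? e) ×-dec (ad X d e Bool.≟ true) ×-dec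
    (((col X d ℕ.≟ a) ×-dec (col X e ℕ.≟ b)) ⊎-dec ((col X d ℕ.≟ b) ×-dec (col X e ℕ.≟ a)))))

  cut : ℕ → ℕ → Bool
  cut a b = does (cut? a b)

  cut-sym : IsFlipFunction cut
  cut-sym a b = bool-ext (λ h → dec-true (cut? b a) (swap (does⇒ (cut? a b) h))) (λ h → dec-true (cut? a b) (swap (does⇒ (cut? b a) h)))
    where
    swap : ∀ {a b} → Cut a b → Cut b a
    swap (d , e , vd , ve , dd , ¬de , h , inj₁ p) = d , e , vd , ve , dd , ¬de , h , inj₂ p
    swap (d , e , vd , ve , dd , ¬de , h , inj₂ p) = d , e , vd , ve , dd , ¬de , h , inj₁ p

  -- One edge leaving `D` with these colours forces all such pairs to be adjacent, by `parallel` or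
  -- `crossed` according to its orientation. Hence the flip erases every edge across the split.
  cut-value : ∀ d e → V d ≡ true → V e ≡ true → D d → ¬ D e → cut (col X d) (col X e) ≡ ad X d e
  cut-value d e vd ve dd ¬de = bool-ext forth
    (λ h → dec-true (cut? _ _) (d , e , vd , ve , dd , ¬de , h , inj₁ (refl , refl)))
    where
    forth : cut (col X d) (col X e) ≡ true → ad X d e ≡ true
    forth h with does⇒ (cut? (col X d) (col X e)) h
    ... | d′ , e′ , vd′ , ve′ , dd′ , ¬de′ , h′ , inj₁ (p , q) = trans (parallel d e d′ e′ vd ve vd′ ve′ dd ¬de dd′ ¬de′ (sym p) (sym q)) h′
    ... | d′ , e′ , vd′ , ve′ , dd′ , ¬de′ , h′ , inj₂ (p , q) = trans (crossed d e d′ e′ vd ve vd′ ve′ dd ¬de dd′ ¬de′ (sym q) (sym p)) h′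

  Y : CGraph N
  Y = flip cut X

  flip-ad : ∀ x y → x ≢ y → ad Y x y ≡ (ad X x y xor cut (col X x) (col X y))
  flip-ad x y ne with x ≟ y
  ... | yes e = ⊥-elim (ne e)
  ... | no _  = refl

  flip-irr : ∀ x → ad Y x x ≡ false
  flip-irr x with x ≟ x
  ... | yes _ = refl
  ... | no ne = ⊥-elim (ne refl)

  flip-symm : ∀ x y → V x ≡ true → V y ≡ true → ad Y x y ≡ ad Y y x
  flip-symm x y vx vy with x ≟ y
  ... | yes refl = sym (flip-irr x)
  ... | no ne = trans (cong₂ _xor_ (symm x y vx vy) (cut-sym _ _)) (sym (flip-ad y x (λ e → ne (sym e))))

  separated : ∀ d e → V d ≡ true → V e ≡ true → D d → ¬ D e → ad Y d e ≡ false
  separated d e vd ve dd ¬de = trans (flip-ad d e (λ { refl → ¬de dd }))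
    (trans (cong (ad X d e xor_) (cut-value d e vd ve dd ¬de)) (xor-same (ad X d e)))

  reach-closed : ∀ i v w → reach Y i v w ≡ true → V w ≡ true × (D v → D w) × (D w → D v)
  reach-closed zero v w h with ∧-true {V v} h
  ... | vv , h′ with v ≟ w
  ...   | yes refl = vv , (λ d → d) , (λ d → d)
  reach-closed (suc i) v w h with ∨-true {reach Y i v w} h
  ... | inj₁ h′ = reach-closed i v w h′
  ... | inj₂ h′ with anyᵇ-elim h′
  ...   | x , hx with ∧-true {reach Y i v x} hx
  ...     | rx , hx′ with ∧-true {ad Y x w} hx′
  ...       | axw , vw with reach-closed i v x rx
  ...         | vx , f , g = vw , (λ dv → forth (f dv)) , (λ dw → g (back dw))
    where
    forth : D x → D w
    forth dx = decidable-stable (D? w) (λ ¬dw → true≢false (trans (sym axw) (separated x w vx vw dx ¬dw)))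
    back : D w → D x
    back dw = decidable-stable (D? x) (λ ¬dx → true≢false (trans (sym axw) (trans (flip-symm x w vx vw) (separated w x vw vx dw ¬dx))))

  reach-refl : ∀ i v → V v ≡ true → reach Y i v v ≡ true
  reach-refl zero v vv = cong₂ _∧_ vv (lem v)
    where
    lem : ∀ v → ⌊ v ≟ v ⌋ ≡ true
    lem v with v ≟ v
    ... | yes _ = refl
    ... | no ne = ⊥-elim (ne refl)
  reach-refl (suc i) v vv rewrite reach-refl i v vv = refl

  Part : Fin N → CGraph N
  Part v = restrict Y (component Y v)

  part-∈ : ∀ v x → inV (Part v) x ≡ true → V x ≡ true × reach Y N v x ≡ true
  part-∈ v x h = ∧-true (trans (sym (lookup∘tabulate (λ w → inV Y w ∧ reach Y N v w) x)) h)

  part-self : ∀ v → V v ≡ true → inV (Part v) v ≡ true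
  part-self v vv = trans (lookup∘tabulate (λ w → inV Y w ∧ reach Y N v w) v) (cong₂ _∧_ vv (reach-refl N v vv))

  -- A component stays on one side of the split, and the other side is inhabited.
  part-smaller : ∀ v → ∣ VS (Part v) ∣ < ∣ VS X ∣
  part-smaller v = p⊂q⇒∣p∣<∣q∣
    ((λ {x} x∈ → lookup⇒[]= x (VS X) (proj₁ (part-∈ v x ([]=⇒lookup x∈)))) , missing)
    where
    missing : ∃ λ x → x ∈ VS X × ¬ (x ∈ VS (Part v))
    missing with D? v
    ... | yes dv = let (e , ve , ¬de) = proper in e , lookup⇒[]= e (VS X) ve ,
            λ e∈ → ¬de (proj₁ (proj₂ (reach-closed N v e (proj₂ (part-∈ v e ([]=⇒lookup e∈))))) dv)
    ... | no ¬dv = let (d , vd , dd) = inhabited in d , lookup⇒[]= d (VS X) vd ,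
            λ d∈ → ¬dv (proj₂ (proj₂ (reach-closed N v d (proj₂ (part-∈ v d ([]=⇒lookup d∈))))) dd)

  part-admissible : ∀ v → V v ≡ true → Admissible W (Part v)
  part-admissible v vv = record
    { symm = λ x y vx vy → flip-symm x y (sub x vx) (sub y vy)
    ; irr = λ x _ → flip-irr x
    ; hom = λ { x y x′ y′ (vx , wx) (vy , wy) (vx′ , wx′) (vy′ , wy′) x≢y x′≢y′ e e′ →
        trans (flip-ad x y x≢y) (trans
          (cong₂ _xor_ (hom x y x′ y′ (sub x vx , wx) (sub y vy , wy) (sub x′ vx′ , wx′) (sub y′ vy′ , wy′) x≢y x′≢y′ e e′) (cong₂ cut e e′))
          (sym (flip-ad x′ y′ x′≢y′))) }
    ; vertex = v , part-self v vv
    }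
    where
    sub : ∀ x → inV (Part v) x ≡ true → V x ≡ true
    sub x h = proj₁ (part-∈ v x h)

-- Construction of the tree.

refined : CGraph N → CGraph N
refined X = recolor X (Refinement.wl X)

marked : Fin N → CGraph N → CGraph N
marked u X = recolor X (individualise u (col X))

HasSplit : CGraph N → Set
HasSplit X = ∃ λ s → Split (inV X) (ad X) (col X) (λ x → lookup s x ≡ true)

mark : ∀ {d} {X : CGraph N} u → inV X u ≡ true → HasIRCTree d (marked u X) → HasIRCTree (suc d) X
mark {X = X} u vu = d4 u (lookup⇒[]= u (VS X) vu) (individualise u (col X))
  (λ v _ v≢u → individualise-other u (col X) v≢u) (λ v _ → individualise-fresh u (col X) v)

single-leaf : ∀ {d} (X : CGraph N) v → inV X v ≡ true → ¬ (∃ λ w → inV X w ≡ true × w ≢ v) → HasIRCTree d X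
single-leaf X v vv none = leaf (trans (cong ∣_∣ (⊆-antisym
  (λ {x} x∈ → subst (_∈ ⁅ v ⁆) (sym (decidable-stable (x ≟ v) (λ ne → none (x , []=⇒lookup x∈ , ne)))) (x∈⁅x⁆ v))
  (λ {x} x∈ → subst (_∈ VS X) (sym (x∈⁅y⁆⇒x≡y v x∈)) (lookup⇒[]= v (VS X) vv)))) (∣⁅x⁆∣≡1 v))

cancel : ∀ p j q → p + j ≤ j + q → p ≤ q
cancel p j q le = +-cancelʳ-≤ j p q (subst (p + j ≤_) (+-comm j q) le)

module _ {N : ℕ} (W : Fin N → Bool) where

  potentialOf : CGraph N → ℕ
  potentialOf X = Potential.potential (inV X) W (col X)

  recolor-admissible : ∀ {X k} → Finer (inV X) k (col X) → Admissible W X → Admissible W (recolor X k)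
  recolor-admissible f adm = record
    { symm = symm
    ; irr = irr
    ; hom = λ x y x′ y′ ux uy ux′ uy′ x≢y x′≢y′ e e′ → hom x y x′ y′ ux uy ux′ uy′ x≢y x′≢y′
        (f x x′ (proj₁ ux) (proj₁ ux′) e) (f y y′ (proj₁ uy) (proj₁ uy′) e′)
    ; vertex = vertex
    }
    where open Admissible adm

  refined-admissible : ∀ {X} → Admissible W X → Admissible W (refined X)
  refined-admissible {X} = recolor-admissible (Refinement.wl-finer X)

  marked-admissible : ∀ {X} u → Admissible W X → Admissible W (marked u X)
  marked-admissible {X} u = recolor-admissible {X} (λ x y _ _ → individualise-finer u (col X) x y)

  Gain : CGraph N → Set
  Gain X = ∃ λ u → inV X u ≡ true × potentialOf (refined (marked u X)) + 3 ≤ potentialOf X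

  Gain₂ : CGraph N → Set
  Gain₂ X = ∃ λ u → ∃ λ v → inV X u ≡ true × inV X v ≡ true × potentialOf (refined (marked v (marked u X))) + 6 ≤ potentialOf X

  gain? : ∀ X → Dec (Gain X)
  gain? X = any? (λ u → (inV X u Bool.≟ true) ×-dec (potentialOf (refined (marked u X)) + 3 ℕ.≤? potentialOf X))

  gain₂? : ∀ X → Dec (Gain₂ X)
  gain₂? X = any? (λ u → any? (λ v → (inV X u Bool.≟ true) ×-dec (inV X v Bool.≟ true) ×-dec
    (potentialOf (refined (marked v (marked u X))) + 6 ℕ.≤? potentialOf X)))

  -- If all three searches fail, the refinements of the individualised graphs instantiate `Stuck`.
  progress : ∀ X → Admissible W X → Equitability.Equitable (inV X) (ad X) (col X) →
    (∀ v → ∃ λ w → inV X w ≡ true × w ≢ v) → Gain X ⊎ Gain₂ X ⊎ HasSplit X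
  progress X adm eq other with gain? X | gain₂? X | anySplit? (inV X) (ad X) (col X)
  ... | yes g | _ | _ = inj₁ g
  ... | _ | yes g | _ = inj₂ (inj₁ g)
  ... | _ | _ | yes s = inj₂ (inj₂ s)
  ... | no ¬g | no ¬g₂ | no ¬s = ⊥-elim (not-stuck {V = inV X} {W} {ad X} {col X} record
    { symm = symm ; irr = irr ; hom = hom ; eq = eq ; vertex = vertex ; other = other
    ; ind = λ u → Refinement.wl (marked u X)
    ; ind-finer = λ u _ x y vx vy e → individualise-finer u (col X) x y (Refinement.wl-finer (marked u X) x y vx vy e)
    ; ind-alone = λ u vu x vx e → individualise-alone u (col X) x (Refinement.wl-finer (marked u X) x u vx vu e)
    ; ind-eq = λ u _ → Refinement.wl-equitable (marked u X)
    ; ind₂ = λ u v → Refinement.wl (marked v (marked u X))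
    ; ind₂-finer = λ u v _ _ x y vx vy e → individualise-finer u (col X) x y
        (individualise-finer v (col (marked u X)) x y (Refinement.wl-finer (marked v (marked u X)) x y vx vy e))
    ; ind₂-aloneˡ = λ u v vu _ x vx e → individualise-alone u (col X) x
        (individualise-finer v (col (marked u X)) x u (Refinement.wl-finer (marked v (marked u X)) x u vx vu e))
    ; ind₂-aloneʳ = λ u v _ vv x vx e →
        individualise-alone v (col (marked u X)) x (Refinement.wl-finer (marked v (marked u X)) x v vx vv e)
    ; ind₂-eq = λ u v _ _ → Refinement.wl-equitable (marked v (marked u X))
    ; no-gain = λ u vu le → ¬g (u , vu , le)
    ; no-gain₂ = λ u v vu vv le → ¬g₂ (u , v , vu , vv , le)
    ; no-split = unsplittable (inV X) (ad X) (col X) ¬s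
    })
    where open Admissible adm

  mutual

    -- The budget `d` falls with individualisations and the size bound `m` with passage to
    -- components. The slack 2 is the largest remainder modulo 3. The bound concerns the refined
    -- colouring because gains are measured after refinement.
    tree : ∀ m d X → Admissible W X → ∣ VS X ∣ ≤ m → potentialOf (refined X) ≤ 2 + d * 3 → HasIRCTree d X
    tree m d X adm size bound = d1 (Refinement.wl X) (Refinement.wl-isWL1 X)
      (stableTree m d (refined X) (refined-admissible adm) (Refinement.wl-equitable X) size bound)

    stableTree : ∀ m d X → Admissible W X → Equitability.Equitable (inV X) (ad X) (col X) →
      ∣ VS X ∣ ≤ m → potentialOf X ≤ 2 + d * 3 → HasIRCTree d X
    stableTree m d X adm eq size bound with Admissible.vertex adm
    ... | v , vv with any? (λ w → (inV X w Bool.≟ true) ×-dec ¬? (w ≟ v))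
    ...   | no none = single-leaf X v vv none
    ...   | yes (w , vw , w≢v) = step m d X adm size bound (progress X adm eq other)
      where
      other : ∀ x → ∃ λ y → inV X y ≡ true × y ≢ x
      other x with x ≟ v
      ... | yes refl = w , vw , w≢v
      ... | no x≢v = v , vv , λ e → x≢v (sym e)

    step : ∀ m d X → Admissible W X → ∣ VS X ∣ ≤ m → potentialOf X ≤ 2 + d * 3 →
      Gain X ⊎ Gain₂ X ⊎ HasSplit X → HasIRCTree d X
    -- The potential is at most 2 and cannot drop by 3.
    step m zero X adm size bound (inj₁ (u , vu , g)) with m+n≤o⇒n≤o (potentialOf (refined (marked u X))) (≤-trans g bound)
    ... | s≤s (s≤s ())
    step m (suc d) X adm size bound (inj₁ (u , vu , g)) = mark u vu
      (tree m d (marked u X) (marked-admissible u adm) size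
        (cancel (potentialOf (refined (marked u X))) 3 (2 + d * 3) (≤-trans g bound)))
    step m zero X adm size bound (inj₂ (inj₁ (u , v , vu , vv , g)))
      with m+n≤o⇒n≤o (potentialOf (refined (marked v (marked u X)))) (≤-trans g bound)
    ... | s≤s (s≤s ())
    -- The potential is at most 5 and cannot drop by 6.
    step m (suc zero) X adm size bound (inj₂ (inj₁ (u , v , vu , vv , g)))
      with m+n≤o⇒n≤o (potentialOf (refined (marked v (marked u X)))) (≤-trans g bound)
    ... | s≤s (s≤s (s≤s (s≤s (s≤s ()))))
    step m (suc (suc d)) X adm size bound (inj₂ (inj₁ (u , v , vu , vv , g))) = mark u vu (mark v vv
      (tree m d (marked v (marked u X)) (marked-admissible v (marked-admissible u adm)) size
        (cancel (potentialOf (refined (marked v (marked u X)))) 6 (2 + d * 3) (≤-trans g bound))))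
    step m d X adm size bound (inj₂ (inj₂ (s , split))) =
      d2 cut cut-sym (d3 λ v v∈ → part m size v ([]=⇒lookup v∈))
      where
      open Disconnect W X adm s split
      part : ∀ m → ∣ VS X ∣ ≤ m → ∀ v → inV X v ≡ true → HasIRCTree d (Part v)
      part zero size v vv = ⊥-elim (n≮0 (≤-trans (part-smaller v) size))
      part (suc m) size v vv = tree m d (Part v) (part-admissible v vv) (s≤s⁻¹ (≤-trans (part-smaller v) size))
        (≤-trans (Potential.potential-mono (inV (Part v)) W (Refinement.wl-finer (Part v)))
          (≤-trans (potential-restrict W (col X) (λ x h → proj₁ (part-∈ v x h))) bound))

-- The bound at the root.

countᵇ-lookup : (C : Subset n) → countᵇ (lookup C) ≡ ∣ C ∣
countᵇ-lookup []          = refl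
countᵇ-lookup (true ∷ C)  = cong suc (countᵇ-lookup C)
countᵇ-lookup (false ∷ C) = countᵇ-lookup C

theorem21 : ∀ {n} (G : Graph (suc n)) (χ : Fin (suc n) → ℕ) (r : ℕ) →
    IsVertexCoverNumber G r →
    Σ ℕ (λ d → (3 * d ≤ 2 * r + 3) × HasIRCTree d (root G χ))
theorem21 {n} G χ r ((C , cover , size) , _) =
  d , ≤-trans (≤-trans (≤-reflexive (*-comm 3 d)) (≤-trans (m≤n+m (d * 3) (2 * r % 3)) (≤-reflexive (sym divide)))) (m≤m+n (2 * r) 3) ,
  tree W ∣ VS X ∣ d X admissible ≤-refl (≤-trans (Potential.potential-mono (inV X) W (Refinement.wl-finer X)) (≤-trans potential≤
    (≤-trans (≤-reflexive divide) (+-monoˡ-≤ (d * 3) (s≤s⁻¹ (m%n<n (2 * r) 3))))))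
  where
  -- The initial potential is at most `2 * r`; the remainder modulo 3 fits into the slack of `tree`.
  d = 2 * r / 3
  divide : 2 * r ≡ 2 * r % 3 + d * 3
  divide = m≡m%n+[m/n]*n (2 * r) 3
  X = root G χ
  W : Fin (suc n) → Bool
  W = lookup C
  open Potential (inV X) W
  independent : ∀ x y → Uncovering x → Uncovering y → adj G x y ≡ false
  independent x y (_ , wx) (_ , wy) = ¬-not λ e → absurd (cover x y e)
    where
    absurd : x ∈ C ⊎ y ∈ C → ⊥
    absurd (inj₁ x∈) = true≢false (trans (sym ([]=⇒lookup x∈)) wx)
    absurd (inj₂ y∈) = true≢false (trans (sym ([]=⇒lookup y∈)) wy)
  admissible : Admissible W X
  admissible = record
    { symm = λ x y _ _ → adj-sym G x y
    ; irr = λ x _ → adj-irrefl G x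
    ; hom = λ x y x′ y′ ux uy ux′ uy′ _ _ _ _ → trans (independent x y ux uy) (sym (independent x′ y′ ux′ uy′))
    ; vertex = zero , refl
    }
  -- Redundant vertices lie in the cover, and the potential is a sum of two redundancies.
  redundancy≤ : ∀ Z Z? → redundancy Z Z? ℕ._≟_ χ ≤ r
  redundancy≤ Z Z? = ≤-trans (countᵇ-mono (λ w h → proj₂ (proj₁ (does⇒ (redundant? Z Z? ℕ._≟_ χ w) h))))
    (≤-reflexive (trans (countᵇ-lookup C) size))
  potential≤ : potential χ ≤ 2 * r
  potential≤ = ≤-trans (+-mono-≤ (redundancy≤ None none?) (redundancy≤ Uncovering uncovering?))
    (≤-reflexive (cong (r +_) (sym (+-identityʳ r))))
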